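{- Let $r,\alpha,\beta,\gamma$ be positive integers and $p$ a prime with $p>\alpha+\beta+\gamma$. If $\alpha+\beta+\gamma$ is odd, then $$Z_{p^r}(\alpha,\beta,\gamma)\equiv p^{r-1}Z_p(\alpha,\beta,\gamma)\pmod{p^r}.$$ If $\alpha+\beta+\gamma$ is even, then $$Z_{p^r}(\alpha,\beta,\gamma)\equiv p^{2r-2}Z_p(\alpha,\beta,\gamma)\pmod{p^{2r}}.$$
   Context: Let $\mathcal{P}_p$ be the set of positive integers not divisible by the prime $p$. For positive integers $r,d,s_1,\dots,s_d$ define $$Z_{p^r}(s_1,\dots,s_d)=\sum_{\substack{k_1+\cdots+k_d=p^r\\ k_1,\dots,k_d\in\mathcal{P}_p}}\frac{1}{k_1^{s_1}\cdots k_d^{s_d}}.$$ Congruences are in the ring of $p$-integral rationals. -}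

module Defs where

open import Data.Nat as ℕ using (ℕ; zero; suc; _+_; _*_; _∸_; _^_; _<_; _<?_)
open import Data.Nat.Divisibility using (_∣_; _∣?_)
open import Data.Integer as ℤ using (ℤ; +_)
open import Data.Rational as ℚ using (ℚ; _/_)
open import Data.List using (List; []; _∷_; applyUpTo; concatMap; foldr)
open import Data.Bool using (Bool; true; false; if_then_else_; _∧_; not)
open import Data.Product using (∃; ∃-syntax; _×_)
open import Relation.Nullary using (¬_; does)
open import Relation.Binary.PropositionalEquality using (_≡_)

-- 1/n as a rational; the case n = 0 never occurs below (all k_i ≥ 1)
inv : ℕ → ℚ
inv zero = ℚ.0ℚ
inv (suc n) = + 1 / suc n

notDiv : ℕ → ℕ → Bool
notDiv p k = not (does (p ∣? k))

sumℚ : List ℚ → ℚ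
sumℚ = foldr ℚ._+_ ℚ.0ℚ

-- Z_N(a,b,c) w.r.t. prime p: sum over k1+k2+k3 = N, k1,k2,k3 ≥ 1, p ∤ k_i,
-- of 1/(k1^a k2^b k3^c).  k1,k2 range over 1..N, k3 = N - k1 - k2 (≥ 1 iff k1+k2 < N).
Z3 : (p N a b c : ℕ) → ℚ
Z3 p N a b c =
  sumℚ (concatMap (λ k₁ → concatMap (λ k₂ →
     let k₃ = N ∸ k₁ ∸ k₂ in
     if does (k₁ + k₂ <? N) ∧ notDiv p k₁ ∧ notDiv p k₂ ∧ notDiv p k₃
       then inv (k₁ ^ a * k₂ ^ b * k₃ ^ c) ∷ []
       else []) (applyUpTo suc N)) (applyUpTo suc N))

-- x ≡ y (mod p^m) in the ring of p-integral rationals: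
-- (x - y)/p^m is p-integral, i.e. b (x - y) = p^m a for integers a, b with p ∤ b.
ModEq : (p m : ℕ) → ℚ → ℚ → Set
ModEq p m x y = ∃[ a ] ∃[ b ] (¬ (p ∣ ℤ.∣ b ∣) ×
  (b / 1) ℚ.* (x ℚ.- y) ≡ ((+ (p ^ m)) / 1) ℚ.* (a / 1))

{-# OPTIONS --safe #-}

-- Put n = p^(r-1) and w = α + β + γ. Modulo a power of p, k^(-s) is a power k^A with A ≡ s mod 2, so
-- Z_{pn} is an integer sum over k₁ + k₂ + k₃ = pn. Writing kᵢ = aᵢ + p xᵢ, the residues aᵢ add up to p
-- or to 2p, and a ↦ p - a exchanges the two kinds. As a function of x, (a + p x)^A is an integral
-- combination of the p^l C(x , l), so the classes with a₁ + a₂ + a₃ = p contribute a combination of the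
-- p^m C(n+1 , m+2); evaluating the same expansions at -1 - x, the complementary classes contribute the
-- same combination with n replaced by -n (Ehrhart reciprocity), up to the sign (-1)^w. Hence Z_{pn} is
-- a combination of the p^m (C(1+n , m+2) + (-1)^w C(1-n , m+2)), which are polynomials in n without
-- constant term of the parity of w. The denominator (m+2)! costs few factors p since p ≥ 5, and
-- therefore modulo (pn)^e, where e = 1 or 2 has the parity of w, only the term m = 0, equal to n^e
-- times its value at n = 1, survives.
module Submission where

open import Defs

-- The argument -1 - x comes from (p - a) + p y = -(a + p (-1 - y)): a complementary class is the
-- original one continued to negative arguments, up to the sign of the power. If the residues add up
-- to p, the quotients xᵢ add up to n - 1; if they add up to 2p, to n - 2. Hence n is written as 2 +
-- t, and r = 1, that is n = 1, is treated apart. The terms with m ≥ 1 are removed as follows. With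
-- v the exponent of p in (m+2)!, and since n^e divides (m+2)! times the symmetrised binomial, the
-- factor p^m yields (pn)^e as soon as e + v ≤ m. For p ≥ 5 one has 4v + 1 ≤ m + 2, which gives this
-- inequality except for e = 2, m = 1. In that case the symmetrised binomial is itself 0, because
-- C(1+n , 3) is odd in n.

module ThreefoldSums where

  open import Data.Bool using (if_then_else_; _∧_; not)
  open import Data.Integer as ℤ using (ℤ; +_; _+_; _*_; _-_; -_; _^_; 0ℤ; 1ℤ; -1ℤ)
  open import Data.Integer.Divisibility.Signed
  import Data.Integer.Properties as ℤ
  open import Data.Integer.Tactic.RingSolver using (solve-∀)
  open import Data.List using (List; []; _∷_; _++_; applyUpTo; concatMap)
  open import Data.Nat as ℕ using (ℕ; zero; suc; z≤n; s≤s; _∸_; _!)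
  open import Data.Nat.Combinatorics using (_C_; nCk+nC[k+1]≡[n+1]C[k+1]; nCn≡1; k>n⇒nCk≡0)
  import Data.Nat.Divisibility as ℕ
  import Data.Nat.DivMod as ℕ
  open import Data.Nat.Induction using (<-rec)
  open import Data.Nat.Primality using (Prime; euclidsLemma; prime⇒nonZero; prime⇒nonTrivial)
  import Data.Nat.Properties as ℕ
  import Data.Nat.Tactic.RingSolver as ℕSolver
  open import Data.Product using (∃-syntax; _×_; _,_)
  open import Data.Rational as ℚ using (ℚ; 0ℚ; 1ℚ; _/_)
  import Data.Rational.Properties as ℚ
  open import Data.Rational.Solver using (module +-*-Solver)
  open import Data.Rational.Unnormalised as ℚᵘ using (mkℚᵘ; *≡*)
  import Data.Rational.Unnormalised.Properties as ℚᵘ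
  open import Data.Sum as Sum using (_⊎_; inj₁; inj₂; [_,_]′)
  open import Function using (_∘_; id)
  open import Relation.Binary.PropositionalEquality
  open import Relation.Nullary using (¬_; Dec; does; yes; no; contradiction)

  -- Finite sums, convolutions and binomial coefficients

  Seq : Set
  Seq = ℕ → ℤ

  ∑ : ℕ → Seq → ℤ
  ∑ zero    f = 0ℤ
  ∑ (suc n) f = f 0 + ∑ n (f ∘ suc)

  ∑-cong : ∀ n {f g : Seq} → (∀ i → i ℕ.< n → f i ≡ g i) → ∑ n f ≡ ∑ n g
  ∑-cong zero    f≡g = refl
  ∑-cong (suc n) f≡g = cong₂ _+_ (f≡g 0 (s≤s z≤n)) (∑-cong n (λ i i<n → f≡g (suc i) (s≤s i<n)))

  ∑-lin : ∀ n c (f g : Seq) → ∑ n (λ i → c * f i + g i) ≡ c * ∑ n f + ∑ n g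
  ∑-lin zero    c f g = sym (trans (ℤ.+-identityʳ (c * 0ℤ)) (ℤ.*-zeroʳ c))
  ∑-lin (suc n) c f g = trans (cong (λ s → c * f 0 + g 0 + s) (∑-lin n c (f ∘ suc) (g ∘ suc)))
    (regroup c (f 0) (g 0) (∑ n (f ∘ suc)) (∑ n (g ∘ suc)))
    where
    regroup : ∀ c a b x y → c * a + b + (c * x + y) ≡ c * (a + x) + (b + y)
    regroup = solve-∀

  ∑-zero : ∀ n {f : Seq} → (∀ i → i ℕ.< n → f i ≡ 0ℤ) → ∑ n f ≡ 0ℤ
  ∑-zero zero    f≡0 = refl
  ∑-zero (suc n) f≡0 = cong₂ _+_ (f≡0 0 (s≤s z≤n)) (∑-zero n (λ i i<n → f≡0 (suc i) (s≤s i<n)))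

  ∑-+ : ∀ n (f g : Seq) → ∑ n (λ i → f i + g i) ≡ ∑ n f + ∑ n g
  ∑-+ n f g = begin
    ∑ n (λ i → f i + g i)      ≡⟨ ∑-cong n (λ i _ → cong (_+ g i) (sym (ℤ.*-identityˡ (f i)))) ⟩
    ∑ n (λ i → 1ℤ * f i + g i) ≡⟨ ∑-lin n 1ℤ f g ⟩
    1ℤ * ∑ n f + ∑ n g         ≡⟨ cong (_+ ∑ n g) (ℤ.*-identityˡ (∑ n f)) ⟩
    ∑ n f + ∑ n g              ∎
    where open ≡-Reasoning

  ∑-*ˡ : ∀ n c (f : Seq) → ∑ n (λ i → c * f i) ≡ c * ∑ n f
  ∑-*ˡ zero    c f = sym (ℤ.*-zeroʳ c)
  ∑-*ˡ (suc n) c f = trans (cong (λ s → c * f 0 + s) (∑-*ˡ n c (f ∘ suc))) (sym (ℤ.*-distribˡ-+ c (f 0) _))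

  ∑-++ : ∀ m n (f : Seq) → ∑ (m ℕ.+ n) f ≡ ∑ m f + ∑ n (λ i → f (m ℕ.+ i))
  ∑-++ zero    n f = sym (ℤ.+-identityˡ _)
  ∑-++ (suc m) n f = trans (cong (λ s → f 0 + s) (∑-++ m n (f ∘ suc))) (sym (ℤ.+-assoc (f 0) _ _))

  ∑-last : ∀ n (f : Seq) → ∑ (suc n) f ≡ ∑ n f + f n
  ∑-last zero    f = ℤ.+-comm (f 0) 0ℤ
  ∑-last (suc n) f = trans (cong (λ s → f 0 + s) (∑-last n (f ∘ suc))) (sym (ℤ.+-assoc (f 0) _ _))

  ∑-reverse : ∀ n (f : Seq) → ∑ n f ≡ ∑ n (λ i → f (n ∸ suc i))
  ∑-reverse zero    f = refl
  ∑-reverse (suc n) f = begin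
    ∑ (suc n) f                             ≡⟨ ∑-last n f ⟩
    ∑ n f + f n                             ≡⟨ cong (_+ f n) (∑-reverse n f) ⟩
    ∑ n (λ i → f (n ∸ suc i)) + f n         ≡⟨ ℤ.+-comm _ (f n) ⟩
    f n + ∑ n (λ i → f (n ∸ suc i))         ∎
    where open ≡-Reasoning

  ∑-∣ : ∀ n {k} {f : Seq} → (∀ i → i ℕ.< n → k ∣ f i) → k ∣ ∑ n f
  ∑-∣ zero    k∣f = divides 0ℤ refl
  ∑-∣ (suc n) k∣f = ∣m∣n⇒∣m+n (k∣f 0 (s≤s z≤n)) (∑-∣ n (λ i i<n → k∣f (suc i) (s≤s i<n)))

  infixl 7 _⋆_

  opaque

    -- The Cauchy product of generating functions: a sum over k₁ + k₂ + k₃ = n becomes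
    -- `(f ⋆ (g ⋆ h)) n`. It is opaque so that convolutions stay atomic in later goals; `⋆-def`
    -- reopens it.
    _⋆_ : Seq → Seq → Seq
    (f ⋆ g) n = ∑ (suc n) (λ i → f i * g (n ∸ i))

    ⋆-def : ∀ (f g : Seq) n → (f ⋆ g) n ≡ ∑ (suc n) (λ i → f i * g (n ∸ i))
    ⋆-def f g n = refl

    ⋆-0 : ∀ (f g : Seq) → (f ⋆ g) 0 ≡ f 0 * g 0
    ⋆-0 f g = ℤ.+-identityʳ (f 0 * g 0)

    ⋆-cong : ∀ {f f′ : Seq} → (∀ x → f x ≡ f′ x) → ∀ {g g′ : Seq} → (∀ x → g x ≡ g′ x) → ∀ n → (f ⋆ g) n ≡ (f′ ⋆ g′) n
    ⋆-cong f≡f′ g≡g′ n = ∑-cong (suc n) (λ i _ → cong₂ _*_ (f≡f′ i) (g≡g′ (n ∸ i)))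

    ⋆-congˡ : ∀ {f f′ : Seq} (g : Seq) → (∀ x → f x ≡ f′ x) → ∀ n → (f ⋆ g) n ≡ (f′ ⋆ g) n
    ⋆-congˡ g f≡f′ = ⋆-cong f≡f′ {g} (λ _ → refl)

    ⋆-congʳ : ∀ (f : Seq) {g g′ : Seq} → (∀ x → g x ≡ g′ x) → ∀ n → (f ⋆ g) n ≡ (f ⋆ g′) n
    ⋆-congʳ f = ⋆-cong {f} (λ _ → refl)

    ⋆-linˡ : ∀ c (f f′ g : Seq) n → ((λ x → c * f x + f′ x) ⋆ g) n ≡ c * (f ⋆ g) n + (f′ ⋆ g) n
    ⋆-linˡ c f f′ g n = trans
      (∑-cong (suc n) (λ i _ → distrib c (f i) (f′ i) (g (n ∸ i))))
      (∑-lin (suc n) c (λ i → f i * g (n ∸ i)) (λ i → f′ i * g (n ∸ i)))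
      where
      distrib : ∀ c a b x → (c * a + b) * x ≡ c * (a * x) + b * x
      distrib = solve-∀

    ⋆-linʳ : ∀ c (f g g′ : Seq) n → (f ⋆ (λ x → c * g x + g′ x)) n ≡ c * (f ⋆ g) n + (f ⋆ g′) n
    ⋆-linʳ c f g g′ n = trans
      (∑-cong (suc n) (λ i _ → distrib c (f i) (g (n ∸ i)) (g′ (n ∸ i))))
      (∑-lin (suc n) c (λ i → f i * g (n ∸ i)) (λ i → f i * g′ (n ∸ i)))
      where
      distrib : ∀ c a b x → a * (c * b + x) ≡ c * (a * b) + a * x
      distrib = solve-∀

    ⋆-+ʳ : ∀ (f g g′ : Seq) n → (f ⋆ (λ x → g x + g′ x)) n ≡ (f ⋆ g) n + (f ⋆ g′) n
    ⋆-+ʳ f g g′ n = trans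
      (∑-cong (suc n) (λ i _ → ℤ.*-distribˡ-+ (f i) (g (n ∸ i)) (g′ (n ∸ i))))
      (∑-+ (suc n) (λ i → f i * g (n ∸ i)) (λ i → f i * g′ (n ∸ i)))

    ⋆-scale : ∀ c d (f g : Seq) n → ((λ x → c * f x) ⋆ (λ x → d * g x)) n ≡ c * d * (f ⋆ g) n
    ⋆-scale c d f g n = trans
      (∑-cong (suc n) (λ i _ → regroup c d (f i) (g (n ∸ i))))
      (∑-*ˡ (suc n) (c * d) (λ i → f i * g (n ∸ i)))
      where
      regroup : ∀ c d a b → c * a * (d * b) ≡ c * d * (a * b)
      regroup = solve-∀

    ⋆-last : ∀ (f g : Seq) n → (f ⋆ g) (suc n) ≡ (f ⋆ (g ∘ suc)) n + f (suc n) * g 0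
    ⋆-last f g n = trans (∑-last (suc n) (λ i → f i * g (suc n ∸ i))) (cong₂ _+_
      (∑-cong (suc n) (λ i i≤n → cong (λ j → f i * g j) (ℕ.+-∸-assoc 1 (ℕ.≤-pred i≤n))))
      (cong (λ j → f (suc n) * g j) (ℕ.n∸n≡0 n)))

  binom : ℕ → Seq
  binom k n = + (n C k)

  binom-suc-suc : ∀ k n → binom (suc k) (suc n) ≡ binom k n + binom (suc k) n
  binom-suc-suc k n = trans (cong +_ (sym (nCk+nC[k+1]≡[n+1]C[k+1] n k))) (ℤ.pos-+ (n C k) (n C suc k))

  -- multichoose k n = C(n + k , k) = (-1)^k C(-1 - n , k).
  multichoose : ℕ → Seq
  multichoose zero    n       = 1ℤ
  multichoose (suc k) zero    = 1ℤ
  multichoose (suc k) (suc n) = multichoose k (suc n) + multichoose (suc k) n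

  multichoose-0 : ∀ k → multichoose k 0 ≡ 1ℤ
  multichoose-0 zero    = refl
  multichoose-0 (suc k) = refl

  -- The hockey-stick identity, by Pascal's rule.
  binom-⋆-const : ∀ k n → (binom k ⋆ binom 0) n ≡ binom (suc k) (suc n)
  binom-⋆-const k zero = begin
    (binom k ⋆ binom 0) 0           ≡⟨ ⋆-0 (binom k) (binom 0) ⟩
    binom k 0 * 1ℤ                  ≡⟨ simp (binom k 0) ⟩
    binom k 0 + binom (suc k) 0     ≡⟨ binom-suc-suc k 0 ⟨
    binom (suc k) 1                 ∎
    where
    open ≡-Reasoning
    simp : ∀ x → x * 1ℤ ≡ x + 0ℤ
    simp = solve-∀
  binom-⋆-const k (suc n) = begin
    (binom k ⋆ binom 0) (suc n)                           ≡⟨ ⋆-last (binom k) (binom 0) n ⟩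
    (binom k ⋆ binom 0) n + binom k (suc n) * 1ℤ          ≡⟨ cong (_+ binom k (suc n) * 1ℤ) (binom-⋆-const k n) ⟩
    binom (suc k) (suc n) + binom k (suc n) * 1ℤ          ≡⟨ simp (binom (suc k) (suc n)) (binom k (suc n)) ⟩
    binom k (suc n) + binom (suc k) (suc n)               ≡⟨ binom-suc-suc k (suc n) ⟨
    binom (suc k) (suc (suc n))                           ∎
    where
    open ≡-Reasoning
    simp : ∀ x y → x + y * 1ℤ ≡ y + x
    simp = solve-∀

  x+y*0≡x : ∀ x y → x + y * 0ℤ ≡ x
  x+y*0≡x = solve-∀

  -- In generating functions: `binom k` is z^k / (1-z)^(k+1), so the product of two is z^(i+j) /
  -- (1-z)^(i+j+2). The induction unfolds the second factor by Pascal's rule.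
  binom-⋆ : ∀ i j n → (binom i ⋆ binom j) n ≡ binom (suc (i ℕ.+ j)) (suc n)
  binom-⋆ i zero    n rewrite ℕ.+-identityʳ i = binom-⋆-const i n
  binom-⋆ i (suc j) zero rewrite ℕ.+-suc i j = begin
    (binom i ⋆ binom (suc j)) 0                  ≡⟨ ⋆-0 (binom i) (binom (suc j)) ⟩
    binom i 0 * 0ℤ                               ≡⟨ ℤ.*-zeroʳ (binom i 0) ⟩
    0ℤ                                           ≡⟨ binom-suc-suc (suc (i ℕ.+ j)) 0 ⟨
    binom (suc (suc (i ℕ.+ j))) 1                ∎
    where open ≡-Reasoning
  binom-⋆ i (suc j) (suc n) = begin
    (binom i ⋆ binom (suc j)) (suc n)
      ≡⟨ ⋆-last (binom i) (binom (suc j)) n ⟩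
    (binom i ⋆ (binom (suc j) ∘ suc)) n + binom i (suc n) * 0ℤ
      ≡⟨ x+y*0≡x _ (binom i (suc n)) ⟩
    (binom i ⋆ (binom (suc j) ∘ suc)) n
      ≡⟨ ⋆-congʳ (binom i) (binom-suc-suc j) n ⟩
    (binom i ⋆ (λ x → binom j x + binom (suc j) x)) n
      ≡⟨ ⋆-+ʳ (binom i) (binom j) (binom (suc j)) n ⟩
    (binom i ⋆ binom j) n + (binom i ⋆ binom (suc j)) n
      ≡⟨ cong₂ _+_ (binom-⋆ i j n) (trans (binom-⋆ i (suc j) n) (cong (λ k → binom (suc k) (suc n)) (ℕ.+-suc i j))) ⟩
    binom (suc (i ℕ.+ j)) (suc n) + binom (suc (suc (i ℕ.+ j))) (suc n)
      ≡⟨ binom-suc-suc (suc (i ℕ.+ j)) (suc n) ⟨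
    binom (suc (suc (i ℕ.+ j))) (suc (suc n))
      ≡⟨ cong (λ k → binom (suc k) (suc (suc n))) (ℕ.+-suc i j) ⟨
    binom (suc (i ℕ.+ suc j)) (suc (suc n)) ∎
    where open ≡-Reasoning

  binom-⋆-⋆ : ∀ i j k n → (binom i ⋆ (binom j ⋆ binom k)) n ≡ binom (2 ℕ.+ (i ℕ.+ (j ℕ.+ k))) (suc (suc n))
  binom-⋆-⋆ i j k n = begin
    (binom i ⋆ (binom j ⋆ binom k)) n
      ≡⟨ ⋆-congʳ (binom i) (binom-⋆ j k) n ⟩
    (binom i ⋆ (binom (suc (j ℕ.+ k)) ∘ suc)) n
      -- The shifted factor is not of the form `binom k`; `⋆-last` read backwards absorbs the shift,
      -- its extra term being a multiple of C(0 , k+1) = 0.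
      ≡⟨ x+y*0≡x _ (binom i (suc n)) ⟨
    (binom i ⋆ (binom (suc (j ℕ.+ k)) ∘ suc)) n + binom i (suc n) * 0ℤ
      ≡⟨ ⋆-last (binom i) (binom (suc (j ℕ.+ k))) n ⟨
    (binom i ⋆ binom (suc (j ℕ.+ k))) (suc n)
      ≡⟨ binom-⋆ i (suc (j ℕ.+ k)) (suc n) ⟩
    binom (suc (i ℕ.+ suc (j ℕ.+ k))) (suc (suc n))
      ≡⟨ cong (λ l → binom (suc l) (suc (suc n))) (ℕ.+-suc i (j ℕ.+ k)) ⟩
    binom (2 ℕ.+ (i ℕ.+ (j ℕ.+ k))) (suc (suc n)) ∎
    where open ≡-Reasoning

  multichoose-⋆-const : ∀ k n → (multichoose k ⋆ multichoose 0) n ≡ multichoose (suc k) n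
  multichoose-⋆-const k zero    = trans (⋆-0 (multichoose k) (multichoose 0)) (cong (_* 1ℤ) (multichoose-0 k))
  multichoose-⋆-const k (suc n) = begin
    (multichoose k ⋆ multichoose 0) (suc n)
      ≡⟨ ⋆-last (multichoose k) (multichoose 0) n ⟩
    (multichoose k ⋆ multichoose 0) n + multichoose k (suc n) * 1ℤ
      ≡⟨ cong (_+ multichoose k (suc n) * 1ℤ) (multichoose-⋆-const k n) ⟩
    multichoose (suc k) n + multichoose k (suc n) * 1ℤ
      ≡⟨ simp (multichoose (suc k) n) (multichoose k (suc n)) ⟩
    multichoose k (suc n) + multichoose (suc k) n ∎
    where
    open ≡-Reasoning
    simp : ∀ x y → x + y * 1ℤ ≡ y + x
    simp = solve-∀

  -- In generating functions: `multichoose k` is 1 / (1-z)^(k+1), so that the exponents i + 1 and j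
  -- + 1 add up.
  multichoose-⋆ : ∀ i j n → (multichoose i ⋆ multichoose j) n ≡ multichoose (suc (i ℕ.+ j)) n
  multichoose-⋆ i zero    n rewrite ℕ.+-identityʳ i = multichoose-⋆-const i n
  multichoose-⋆ i (suc j) zero = trans (⋆-0 (multichoose i) (multichoose (suc j))) (cong (_* 1ℤ) (multichoose-0 i))
  multichoose-⋆ i (suc j) (suc n) = begin
    (M i ⋆ M (suc j)) (suc n)
      ≡⟨ ⋆-last (M i) (M (suc j)) n ⟩
    (M i ⋆ (λ x → M j (suc x) + M (suc j) x)) n + M i (suc n) * 1ℤ
      ≡⟨ cong (_+ M i (suc n) * 1ℤ) (⋆-+ʳ (M i) (M j ∘ suc) (M (suc j)) n) ⟩
    (M i ⋆ (M j ∘ suc)) n + (M i ⋆ M (suc j)) n + M i (suc n) * 1ℤ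
      ≡⟨ swap ((M i ⋆ (M j ∘ suc)) n) ((M i ⋆ M (suc j)) n) (M i (suc n) * 1ℤ) ⟩
    (M i ⋆ (M j ∘ suc)) n + M i (suc n) * 1ℤ + (M i ⋆ M (suc j)) n
      ≡⟨ cong (λ x → (M i ⋆ (M j ∘ suc)) n + M i (suc n) * x + (M i ⋆ M (suc j)) n) (multichoose-0 j) ⟨
    (M i ⋆ (M j ∘ suc)) n + M i (suc n) * M j 0 + (M i ⋆ M (suc j)) n
      ≡⟨ cong (_+ (M i ⋆ M (suc j)) n) (⋆-last (M i) (M j) n) ⟨
    (M i ⋆ M j) (suc n) + (M i ⋆ M (suc j)) n
      ≡⟨ cong₂ _+_ (multichoose-⋆ i j (suc n)) (multichoose-⋆ i (suc j) n) ⟩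
    M (suc (i ℕ.+ j)) (suc n) + M (suc (i ℕ.+ suc j)) n
      ≡⟨ cong (λ k → M k (suc n) + M (suc (i ℕ.+ suc j)) n) (ℕ.+-suc i j) ⟨
    M (suc (i ℕ.+ suc j)) (suc n) ∎
    where
    open ≡-Reasoning
    M = multichoose
    swap : ∀ x y z → x + y + z ≡ x + z + y
    swap = solve-∀

  multichoose-⋆-⋆ : ∀ i j k n → (multichoose i ⋆ (multichoose j ⋆ multichoose k)) n ≡ multichoose (2 ℕ.+ (i ℕ.+ (j ℕ.+ k))) n
  multichoose-⋆-⋆ i j k n = begin
    (multichoose i ⋆ (multichoose j ⋆ multichoose k)) n ≡⟨ ⋆-congʳ (multichoose i) (multichoose-⋆ j k) n ⟩
    (multichoose i ⋆ multichoose (suc (j ℕ.+ k))) n     ≡⟨ multichoose-⋆ i (suc (j ℕ.+ k)) n ⟩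
    multichoose (suc (i ℕ.+ suc (j ℕ.+ k))) n           ≡⟨ cong (λ l → multichoose (suc l) n) (ℕ.+-suc i (j ℕ.+ k)) ⟩
    multichoose (2 ℕ.+ (i ℕ.+ (j ℕ.+ k))) n             ∎
    where open ≡-Reasoning

  -- Over the integers the identity persists for k ≥ n, where both sides are 0. It drives both the
  -- factorial formulas and the Newton expansions.
  binom-absorption : ∀ k n → + suc k * binom (suc k) n ≡ (+ n - + k) * binom k n
  binom-absorption zero    zero    = refl
  binom-absorption (suc k) zero    = trans (ℤ.*-zeroʳ (+ suc (suc k))) (sym (ℤ.*-zeroʳ (0ℤ - + suc k)))
  binom-absorption zero    (suc n) = begin
    1ℤ * binom 1 (suc n)      ≡⟨ cong (1ℤ *_) (binom-suc-suc 0 n) ⟩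
    1ℤ * (1ℤ + binom 1 n)     ≡⟨ expand (binom 1 n) ⟩
    1ℤ + 1ℤ * binom 1 n       ≡⟨ cong (λ x → 1ℤ + x) (binom-absorption 0 n) ⟩
    1ℤ + (+ n - 0ℤ) * 1ℤ      ≡⟨ collect (+ n) ⟩
    ((1ℤ + + n) - 0ℤ) * 1ℤ    ∎
    where
    open ≡-Reasoning
    expand : ∀ x → 1ℤ * (1ℤ + x) ≡ 1ℤ + 1ℤ * x
    expand = solve-∀
    collect : ∀ x → 1ℤ + (x - 0ℤ) * 1ℤ ≡ ((1ℤ + x) - 0ℤ) * 1ℤ
    collect = solve-∀
  binom-absorption (suc k) (suc n) = begin
    + suc (suc k) * binom (suc (suc k)) (suc n)
      ≡⟨ cong (+ suc (suc k) *_) (binom-suc-suc (suc k) n) ⟩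
    + suc (suc k) * (B₁ + B₂)
      ≡⟨ expand (+ suc k) B₁ B₂ ⟩
    + suc k * B₁ + B₁ + + suc (suc k) * B₂
      ≡⟨ cong₂ (λ x y → x + B₁ + y) (binom-absorption k n) (binom-absorption (suc k) n) ⟩
    (+ n - + k) * B₀ + B₁ + (+ n - + suc k) * B₁
      ≡⟨ collect (+ n) (+ k) B₀ B₁ ⟩
    (+ suc n - + suc k) * (B₀ + B₁)
      ≡⟨ cong ((+ suc n - + suc k) *_) (binom-suc-suc k n) ⟨
    (+ suc n - + suc k) * binom (suc k) (suc n) ∎
    where
    open ≡-Reasoning
    B₀ = binom k n
    B₁ = binom (suc k) n
    B₂ = binom (suc (suc k)) n
    expand : ∀ k x y → (1ℤ + k) * (x + y) ≡ k * x + x + (1ℤ + k) * y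
    expand = solve-∀
    collect : ∀ n k x y → (n - k) * x + y + (n - (1ℤ + k)) * y ≡ ((1ℤ + n) - (1ℤ + k)) * (x + y)
    collect = solve-∀

  -- Proved together with `multichoose-shift`: Pascal's rule leaves one summand with n lowered and
  -- one with k lowered, and each of the two identities converts a summand for the other.
  multichoose-absorption : ∀ k n → + suc k * multichoose (suc k) n ≡ (+ suc n + + k) * multichoose k n
  multichoose-shift : ∀ k n → + suc n * multichoose k (suc n) ≡ (+ suc n + + k) * multichoose k n

  multichoose-absorption k zero rewrite multichoose-0 k = refl
  multichoose-absorption k (suc n) = begin
    + suc k * (M₁ + M₂)
      ≡⟨ ℤ.*-distribˡ-+ (+ suc k) M₁ M₂ ⟩
    + suc k * M₁ + + suc k * M₂
      ≡⟨ cong (λ s → + suc k * M₁ + s) (trans (multichoose-absorption k n) (sym (multichoose-shift k n))) ⟩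
    + suc k * M₁ + + suc n * M₁
      ≡⟨ collect (+ k) (+ suc n) M₁ ⟩
    (+ suc (suc n) + + k) * M₁ ∎
    where
    open ≡-Reasoning
    M₁ = multichoose k (suc n)
    M₂ = multichoose (suc k) n
    collect : ∀ k n x → (1ℤ + k) * x + n * x ≡ ((1ℤ + n) + k) * x
    collect = solve-∀

  multichoose-shift zero    n = cong (_* 1ℤ) (sym (ℤ.+-identityʳ (+ suc n)))
  multichoose-shift (suc k) n = begin
    + suc n * (M₁ + M₂)
      ≡⟨ ℤ.*-distribˡ-+ (+ suc n) M₁ M₂ ⟩
    + suc n * M₁ + + suc n * M₂
      ≡⟨ cong (_+ + suc n * M₂) (trans (multichoose-shift k n) (sym (multichoose-absorption k n))) ⟩
    + suc k * M₂ + + suc n * M₂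
      ≡⟨ collect (+ suc k) (+ suc n) M₂ ⟩
    (+ suc n + + suc k) * M₂ ∎
    where
    open ≡-Reasoning
    M₁ = multichoose k (suc n)
    M₂ = multichoose (suc k) n
    collect : ∀ k n x → k * x + n * x ≡ (n + k) * x
    collect = solve-∀

  -- Valuations of factorials, rising factorials

  ^-distribʳ-* : ∀ i j n → (i * j) ^ n ≡ i ^ n * j ^ n
  ^-distribʳ-* i j zero    = refl
  ^-distribʳ-* i j (suc n) = trans (cong (i * j *_) (^-distribʳ-* i j n)) (swap i j (i ^ n) (j ^ n))
    where
    swap : ∀ a b c d → a * b * (c * d) ≡ a * c * (b * d)
    swap = solve-∀

  pos-^ : ∀ m n → + (m ℕ.^ n) ≡ (+ m) ^ n
  pos-^ m zero    = refl
  pos-^ m (suc n) = trans (ℤ.pos-* m (m ℕ.^ n)) (cong (+ m *_) (pos-^ m n))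

  -x≡-1*x : ∀ x → - x ≡ -1ℤ * x
  -x≡-1*x = solve-∀

  ^-neg : ∀ x n → (- x) ^ n ≡ -1ℤ ^ n * x ^ n
  ^-neg x n = trans (cong (_^ n) (-x≡-1*x x)) (^-distribʳ-* -1ℤ x n)

  euclid : ∀ {p} → Prime p → ∀ i j → + p ∣ i * j → + p ∣ i ⊎ + p ∣ j
  euclid p-prime i j p∣ij = Sum.map ∣ᵤ⇒∣ ∣ᵤ⇒∣
    (euclidsLemma ℤ.∣ i ∣ ℤ.∣ j ∣ p-prime (subst (_ ℕ.∣_) (ℤ.abs-* i j) (∣⇒∣ᵤ p∣ij)))

  ∤-* : ∀ {p} → Prime p → ∀ {m n} → ¬ p ℕ.∣ m → ¬ p ℕ.∣ n → ¬ p ℕ.∣ m ℕ.* n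
  ∤-* p-prime p∤m p∤n p∣mn = [ p∤m , p∤n ]′ (euclidsLemma _ _ p-prime p∣mn)

  prime^-cancel-∣ : ∀ {p} → Prime p → ∀ {c} → ¬ p ℕ.∣ c → ∀ k x → (+ p) ^ k ∣ + c * x → (+ p) ^ k ∣ x
  prime^-cancel-∣ p-prime p∤c zero    x _ = divides x (sym (ℤ.*-identityʳ x))
  prime^-cancel-∣ {p} p-prime {c} p∤c (suc k) x pᵏ⁺¹∣cx
    with euclid p-prime (+ c) x (∣-trans (∣m⇒∣m*n ((+ p) ^ k) ∣-refl) pᵏ⁺¹∣cx)
  ... | inj₁ p∣c = contradiction (∣⇒∣ᵤ p∣c) p∤c
  ... | inj₂ (divides q refl) = subst (+ p * (+ p) ^ k ∣_) (ℤ.*-comm (+ p) q)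
    (*-monoʳ-∣ (+ p) (prime^-cancel-∣ p-prime p∤c k q
      (*-cancelˡ-∣ (+ p) {{prime⇒nonZero p-prime}} (subst (+ p * (+ p) ^ k ∣_) (swap (+ c) q (+ p)) pᵏ⁺¹∣cx))))
    where
    swap : ∀ c q p → c * (q * p) ≡ p * (c * q)
    swap = solve-∀

  p∤1 : ∀ {p} → Prime p → ¬ p ℕ.∣ 1
  p∤1 p-prime p∣1 = ℕ.nonTrivial⇒≢1 {{prime⇒nonTrivial p-prime}} (ℕ.∣1⇒≡1 p∣1)

  p∤0<m<p : ∀ {p m} → 0 ℕ.< m → m ℕ.< p → ¬ p ℕ.∣ m
  p∤0<m<p {m = suc _} 0<m m<p p∣m = ℕ.<⇒≱ m<p (ℕ.∣⇒≤ p∣m)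

  -- The s factors above m lie strictly between two consecutive multiples of p.
  factorial-above-multiple : ∀ {p} → Prime p → ∀ {m} → p ℕ.∣ m → ∀ s → s ℕ.< p →
    ∃[ u ] ¬ p ℕ.∣ u × (s ℕ.+ m) ! ≡ u ℕ.* m !
  factorial-above-multiple p-prime {m} p∣m zero s<p = 1 , p∤1 p-prime , sym (ℕ.+-identityʳ (m !))
  factorial-above-multiple {p} p-prime {m} p∣m (suc s) s<p
    with u , p∤u , eq ← factorial-above-multiple p-prime p∣m s (ℕ.<-trans (ℕ.n<1+n s) s<p)
    = (suc s ℕ.+ m) ℕ.* u
    , ∤-* p-prime (λ p∣s+m → p∤0<m<p (s≤s z≤n) s<p (ℕ.∣m+n∣m⇒∣n (subst (p ℕ.∣_) (ℕ.+-comm (suc s) m) p∣s+m) p∣m)) p∤u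
    , trans (cong ((suc s ℕ.+ m) ℕ.*_) eq) (sym (ℕ.*-assoc (suc s ℕ.+ m) u (m !)))

  factorial-multiple : ∀ {p} → Prime p → ∀ q → ∃[ u ] ¬ p ℕ.∣ u × (p ℕ.* q) ! ≡ u ℕ.* p ℕ.^ q ℕ.* q !
  factorial-multiple {p} p-prime zero = 1 , p∤1 p-prime , cong _! (ℕ.*-zeroʳ p)
  factorial-multiple {suc p′} p-prime (suc q)
    with u , p∤u , eq ← factorial-multiple p-prime q
       | v , p∤v , eq′ ← factorial-above-multiple p-prime (ℕ.m∣m*n {suc p′} q) p′ ℕ.≤-refl
    = v ℕ.* u , ∤-* p-prime p∤v p∤u , (begin
      (p ℕ.* suc q) !
        ≡⟨ cong _! (ℕ.*-suc p q) ⟩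
      (p ℕ.+ p ℕ.* q) ℕ.* (p′ ℕ.+ p ℕ.* q) !
        ≡⟨ cong ((p ℕ.+ p ℕ.* q) ℕ.*_) (trans eq′ (cong (v ℕ.*_) eq)) ⟩
      (p ℕ.+ p ℕ.* q) ℕ.* (v ℕ.* (u ℕ.* p ℕ.^ q ℕ.* q !))
        ≡⟨ regroup p q v u (p ℕ.^ q) (q !) ⟩
      v ℕ.* u ℕ.* (p ℕ.* p ℕ.^ q) ℕ.* (suc q ℕ.* q !) ∎)
    where
    open ≡-Reasoning
    p = suc p′
    regroup : ∀ p q v u x y → (p ℕ.+ p ℕ.* q) ℕ.* (v ℕ.* (u ℕ.* x ℕ.* y)) ≡ v ℕ.* u ℕ.* (p ℕ.* x) ℕ.* ((1 ℕ.+ q) ℕ.* y)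
    regroup = ℕSolver.solve-∀

  -- Legendre's bound v ≤ (n - 1)/(p - 1), weakened by p ≥ 5.
  factorial-valuation : ∀ {p} → Prime p → 5 ℕ.≤ p → ∀ n → 1 ℕ.≤ n →
    ∃[ c ] ∃[ v ] ¬ p ℕ.∣ c × n ! ≡ c ℕ.* p ℕ.^ v × 4 ℕ.* v ℕ.+ 1 ℕ.≤ n
  factorial-valuation {p} p-prime 5≤p = <-rec _ step
    where
    instance _ = prime⇒nonZero p-prime
    valuation-bound : ∀ s q v → 4 ℕ.* v ℕ.+ 1 ℕ.≤ q → 4 ℕ.* (q ℕ.+ v) ℕ.+ 1 ℕ.≤ s ℕ.+ q ℕ.* p
    valuation-bound s q v bound = begin
      4 ℕ.* (q ℕ.+ v) ℕ.+ 1                 ≡⟨ split q v ⟩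
      4 ℕ.* q ℕ.+ (4 ℕ.* v ℕ.+ 1)           ≤⟨ ℕ.+-monoʳ-≤ (4 ℕ.* q) bound ⟩
      4 ℕ.* q ℕ.+ q                         ≡⟨ collect q ⟩
      q ℕ.* 5                               ≤⟨ ℕ.*-monoʳ-≤ q 5≤p ⟩
      q ℕ.* p                               ≤⟨ ℕ.m≤n+m (q ℕ.* p) s ⟩
      s ℕ.+ q ℕ.* p                         ∎
      where
      open ℕ.≤-Reasoning
      split : ∀ q v → 4 ℕ.* (q ℕ.+ v) ℕ.+ 1 ≡ 4 ℕ.* q ℕ.+ (4 ℕ.* v ℕ.+ 1)
      split = ℕSolver.solve-∀
      collect : ∀ q → 4 ℕ.* q ℕ.+ q ≡ q ℕ.* 5
      collect = ℕSolver.solve-∀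
    step : ∀ n → (∀ {m} → m ℕ.< n → 1 ℕ.≤ m → ∃[ c ] ∃[ v ] ¬ p ℕ.∣ c × m ! ≡ c ℕ.* p ℕ.^ v × 4 ℕ.* v ℕ.+ 1 ℕ.≤ m) →
      1 ℕ.≤ n → ∃[ c ] ∃[ v ] ¬ p ℕ.∣ c × n ! ≡ c ℕ.* p ℕ.^ v × 4 ℕ.* v ℕ.+ 1 ℕ.≤ n
    -- With n = s + q p the exponent of p in n! is q plus that in q!, and 4q plus the bound for q
    -- gives at most 5q ≤ q p ≤ n. The case q = 0 has exponent 0, which is why 1 ≤ n is assumed.
    step n rec 1≤n with n ℕ.% p | n ℕ./ p | ℕ.m≡m%n+[m/n]*n n p | ℕ.m%n<n n p
    ... | s | zero | refl | s<p
      with u , p∤u , eq ← factorial-above-multiple p-prime {0} (p ℕ.∣0) s s<p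
      = u , 0 , p∤u , eq , 1≤n
    ... | s | q@(suc q-1) | refl | s<p
      with u , p∤u , eq ← factorial-above-multiple p-prime (ℕ.m∣m*n {p} q) s s<p
         | w , p∤w , eq′ ← factorial-multiple p-prime q
         | c , v , p∤c , eq″ , bound ← rec (ℕ.<-≤-trans (ℕ.m<m*n q p (ℕ.≤-trans (s≤s (s≤s z≤n)) 5≤p)) (ℕ.m≤n+m (q ℕ.* p) s)) (s≤s z≤n)
      = u ℕ.* w ℕ.* c , q ℕ.+ v , ∤-* p-prime (∤-* p-prime p∤u p∤w) p∤c
      , (begin
        (s ℕ.+ q ℕ.* p) !                                     ≡⟨ cong (λ x → (s ℕ.+ x) !) (ℕ.*-comm q p) ⟩
        (s ℕ.+ p ℕ.* q) !                                     ≡⟨ trans eq (cong (u ℕ.*_) eq′) ⟩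
        u ℕ.* (w ℕ.* p ℕ.^ q ℕ.* q !)                         ≡⟨ cong (λ x → u ℕ.* (w ℕ.* p ℕ.^ q ℕ.* x)) eq″ ⟩
        u ℕ.* (w ℕ.* p ℕ.^ q ℕ.* (c ℕ.* p ℕ.^ v))             ≡⟨ regroup u w c (p ℕ.^ q) (p ℕ.^ v) ⟩
        u ℕ.* w ℕ.* c ℕ.* (p ℕ.^ q ℕ.* p ℕ.^ v)               ≡⟨ cong (u ℕ.* w ℕ.* c ℕ.*_) (ℕ.^-distribˡ-+-* p q v) ⟨
        u ℕ.* w ℕ.* c ℕ.* p ℕ.^ (q ℕ.+ v)                     ∎)
      , valuation-bound s q v bound
      where
      open ≡-Reasoning
      regroup : ∀ u w c x y → u ℕ.* (w ℕ.* x ℕ.* (c ℕ.* y)) ≡ u ℕ.* w ℕ.* c ℕ.* (x ℕ.* y)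
      regroup = ℕSolver.solve-∀

  rising : ℤ → ℕ → ℤ
  rising x zero    = 1ℤ
  rising x (suc k) = rising x k * (x + + k)

  -- At x = 1 + t and at x = -(3 + t) the first three factors have the same product up to sign,
  -- (1+t)(2+t)(3+t). Splitting them off exposes the common factor (n-1) n (n+1) of the two
  -- symmetrised binomials.
  rising-3 : ∀ x k → rising x (3 ℕ.+ k) ≡ x * (x + 1ℤ) * (x + + 2) * rising (x + + 3) k
  rising-3 x zero    = base x
    where
    base : ∀ x → 1ℤ * (x + 0ℤ) * (x + 1ℤ) * (x + + 2) ≡ x * (x + 1ℤ) * (x + + 2) * 1ℤ
    base = solve-∀
  rising-3 x (suc k) = trans (cong (_* (x + (+ 3 + + k))) (rising-3 x k)) (assoc x (rising (x + + 3) k) (+ k))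
    where
    assoc : ∀ x r k → x * (x + 1ℤ) * (x + + 2) * r * (x + (+ 3 + k)) ≡ x * (x + 1ℤ) * (x + + 2) * (r * (x + + 3 + k))
    assoc = solve-∀

  rising-cong-∣ : ∀ {d x y} → d ∣ x - y → ∀ k → d ∣ rising x k - rising y k
  rising-cong-∣ d∣x-y zero    = divides 0ℤ refl
  rising-cong-∣ {d} {x} {y} d∣x-y (suc k) = subst (d ∣_) (telescope (rising x k) (rising y k) x y (+ k))
    (∣m∣n⇒∣m+n (∣m⇒∣m*n (x + + k) (rising-cong-∣ d∣x-y k)) (∣n⇒∣m*n (rising y k) d∣x-y))
    where
    telescope : ∀ a b x y k → (a - b) * (x + k) + b * (x - y) ≡ a * (x + k) - b * (y + k)
    telescope = solve-∀

  -- A falling factorial of n is a rising factorial of -n up to sign. Both kinds of binomials are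
  -- thus expressed through `rising`, at arguments that can be compared modulo n.
  factorial*binom : ∀ k n → + (k !) * binom k n ≡ -1ℤ ^ k * rising (- + n) k
  factorial*binom zero    n = refl
  factorial*binom (suc k) n = begin
    + (suc k ℕ.* k !) * binom (suc k) n            ≡⟨ cong (_* binom (suc k) n) (ℤ.pos-* (suc k) (k !)) ⟩
    + suc k * + (k !) * binom (suc k) n            ≡⟨ swap (+ suc k) (+ (k !)) (binom (suc k) n) ⟩
    + (k !) * (+ suc k * binom (suc k) n)          ≡⟨ cong (+ (k !) *_) (binom-absorption k n) ⟩
    + (k !) * ((+ n - + k) * binom k n)            ≡⟨ swap′ (+ (k !)) (+ n - + k) (binom k n) ⟩
    (+ n - + k) * (+ (k !) * binom k n)            ≡⟨ cong ((+ n - + k) *_) (factorial*binom k n) ⟩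
    (+ n - + k) * (-1ℤ ^ k * rising (- + n) k)     ≡⟨ sign (+ n) (+ k) (-1ℤ ^ k) (rising (- + n) k) ⟩
    -1ℤ * -1ℤ ^ k * (rising (- + n) k * (- + n + + k)) ∎
    where
    open ≡-Reasoning
    swap : ∀ a b c → a * b * c ≡ b * (a * c)
    swap = solve-∀
    swap′ : ∀ a b c → a * (b * c) ≡ b * (a * c)
    swap′ = solve-∀
    sign : ∀ n k s r → (n - k) * (s * r) ≡ -1ℤ * s * (r * (- n + k))
    sign = solve-∀

  factorial*multichoose : ∀ k n → + (k !) * multichoose k n ≡ rising (+ suc n) k
  factorial*multichoose zero    n = refl
  factorial*multichoose (suc k) n = begin
    + (suc k ℕ.* k !) * multichoose (suc k) n      ≡⟨ cong (_* multichoose (suc k) n) (ℤ.pos-* (suc k) (k !)) ⟩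
    + suc k * + (k !) * multichoose (suc k) n      ≡⟨ swap (+ suc k) (+ (k !)) (multichoose (suc k) n) ⟩
    + (k !) * (+ suc k * multichoose (suc k) n)    ≡⟨ cong (+ (k !) *_) (multichoose-absorption k n) ⟩
    + (k !) * ((+ suc n + + k) * multichoose k n)  ≡⟨ swap′ (+ (k !)) (+ suc n + + k) (multichoose k n) ⟩
    + (k !) * multichoose k n * (+ suc n + + k)    ≡⟨ cong (_* (+ suc n + + k)) (factorial*multichoose k n) ⟩
    rising (+ suc n) k * (+ suc n + + k)           ∎
    where
    open ≡-Reasoning
    swap : ∀ a b c → a * b * c ≡ b * (a * c)
    swap = solve-∀
    swap′ : ∀ a b c → a * (b * c) ≡ a * c * b
    swap′ = solve-∀

  -- With n = 2 + t this is C(1 + n , 2 + m) + (-1)^e C(1 - n , 2 + m): the parity of e is its parity in n.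
  symmetrised : ℕ → ℕ → ℕ → ℤ
  symmetrised e m t = binom (2 ℕ.+ m) (3 ℕ.+ t) + -1ℤ ^ e * (-1ℤ ^ m * multichoose (2 ℕ.+ m) t)

  -- The bracket in the last factor is divisible by n = 2 + t when e = 2, because 4 + t ≡ - t mod n.
  factorial*symmetrised : ∀ e k t → + ((3 ℕ.+ k) !) * symmetrised e (suc k) t ≡
    -1ℤ ^ suc k * ((+ 1 + + t) * (+ 2 + + t) * (+ 3 + + t) * (-1ℤ ^ e * rising (+ 4 + + t) k - rising (- + t) k))
  factorial*symmetrised e k t = begin
    F * (binom (3 ℕ.+ k) (3 ℕ.+ t) + σ * (s * multichoose (3 ℕ.+ k) t))
      ≡⟨ distrib F (binom (3 ℕ.+ k) (3 ℕ.+ t)) σ s (multichoose (3 ℕ.+ k) t) ⟩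
    F * binom (3 ℕ.+ k) (3 ℕ.+ t) + σ * (s * (F * multichoose (3 ℕ.+ k) t))
      ≡⟨ cong₂ (λ x y → x + σ * (s * y)) (factorial*binom (3 ℕ.+ k) (3 ℕ.+ t)) (factorial*multichoose (3 ℕ.+ k) t) ⟩
    -1ℤ ^ (3 ℕ.+ k) * rising x (3 ℕ.+ k) + σ * (s * rising y (3 ℕ.+ k))
      ≡⟨ cong₂ (λ x y → -1ℤ ^ (3 ℕ.+ k) * x + σ * (s * y)) (rising-3 x k) (rising-3 y k) ⟩
    -1ℤ ^ (3 ℕ.+ k) * (x * (x + 1ℤ) * (x + + 2) * rising (x + + 3) k)
      + σ * (s * (y * (y + 1ℤ) * (y + + 2) * rising (y + + 3) k))
      ≡⟨ cong₂ (λ u v → -1ℤ ^ (3 ℕ.+ k) * (x * (x + 1ℤ) * (x + + 2) * rising u k)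
           + σ * (s * (y * (y + 1ℤ) * (y + + 2) * rising v k))) (shift-x (+ t)) (shift-y (+ t)) ⟩
    -1ℤ ^ (3 ℕ.+ k) * (x * (x + 1ℤ) * (x + + 2) * rising (- + t) k)
      + σ * (s * (y * (y + 1ℤ) * (y + + 2) * rising (+ 4 + + t) k))
      ≡⟨ collect (-1ℤ ^ k) σ (+ t) (rising (- + t) k) (rising (+ 4 + + t) k) ⟩
    s * ((+ 1 + + t) * (+ 2 + + t) * (+ 3 + + t) * (σ * rising (+ 4 + + t) k - rising (- + t) k)) ∎
    where
    open ≡-Reasoning
    F = + ((3 ℕ.+ k) !)
    σ = -1ℤ ^ e
    s = -1ℤ ^ suc k
    x = - + (3 ℕ.+ t)
    y = + suc t
    distrib : ∀ f b σ s m → f * (b + σ * (s * m)) ≡ f * b + σ * (s * (f * m))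
    distrib = solve-∀
    shift-x : ∀ t → - (+ 3 + t) + + 3 ≡ - t
    shift-x = solve-∀
    shift-y : ∀ t → 1ℤ + t + + 3 ≡ + 4 + t
    shift-y = solve-∀
    collect : ∀ s σ t a b → -1ℤ * (-1ℤ * (-1ℤ * s)) * (- (+ 3 + t) * (- (+ 3 + t) + 1ℤ) * (- (+ 3 + t) + + 2) * a)
      + σ * (-1ℤ * s * ((1ℤ + t) * (1ℤ + t + 1ℤ) * (1ℤ + t + + 2) * b))
      ≡ -1ℤ * s * ((+ 1 + t) * (+ 2 + t) * (+ 3 + t) * (σ * b - a))
    collect = solve-∀

  rising-reflection : ∀ t k → + 2 + + t ∣ rising (+ 4 + + t) k - rising (- + t) k
  rising-reflection t k = rising-cong-∣ {x = + 4 + + t} {y = - + t} (divides (+ 2) (double (+ t))) k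
    where
    double : ∀ t → (+ 4 + t) - (- t) ≡ + 2 * (+ 2 + t)
    double = solve-∀

  -- One factor n is visible among the three consecutive ones; for e = 2 the second comes from the
  -- bracket through `rising-reflection`.
  ∣factorial*symmetrised : ∀ e → e ≡ 1 ⊎ e ≡ 2 → ∀ k t →
    (+ 2 + + t) ^ e ∣ + ((3 ℕ.+ k) !) * symmetrised e (suc k) t
  ∣factorial*symmetrised .1 (inj₁ refl) k t =
    divides (s * ((+ 1 + + t) * (+ 3 + + t) * bracket))
      (trans (factorial*symmetrised 1 k t) (regroup s (+ t) bracket))
    where
    s = -1ℤ ^ suc k
    bracket = -1ℤ ^ 1 * rising (+ 4 + + t) k - rising (- + t) k
    regroup : ∀ s t b → s * ((+ 1 + t) * (+ 2 + t) * (+ 3 + t) * b) ≡ s * ((+ 1 + t) * (+ 3 + t) * b) * ((+ 2 + t) * 1ℤ)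
    regroup = solve-∀
  ∣factorial*symmetrised .2 (inj₂ refl) k t
    with divides q eq ← rising-reflection t k
    = divides (s * ((+ 1 + + t) * (+ 3 + + t) * q)) (begin
      + ((3 ℕ.+ k) !) * symmetrised 2 (suc k) t
        ≡⟨ factorial*symmetrised 2 k t ⟩
      s * ((+ 1 + + t) * (+ 2 + + t) * (+ 3 + + t) * (1ℤ * rising (+ 4 + + t) k - rising (- + t) k))
        ≡⟨ cong (λ x → s * ((+ 1 + + t) * (+ 2 + + t) * (+ 3 + + t) * x))
             (trans (cong (_- rising (- + t) k) (ℤ.*-identityˡ (rising (+ 4 + + t) k))) eq) ⟩
      s * ((+ 1 + + t) * (+ 2 + + t) * (+ 3 + + t) * (q * (+ 2 + + t)))
        ≡⟨ regroup s (+ t) q ⟩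
      s * ((+ 1 + + t) * (+ 3 + + t) * q) * (+ 2 + + t) ^ 2 ∎)
    where
    open ≡-Reasoning
    s = -1ℤ ^ suc k
    regroup : ∀ s t q → s * ((+ 1 + t) * (+ 2 + t) * (+ 3 + t) * (q * (+ 2 + t)))
      ≡ s * ((+ 1 + t) * (+ 3 + t) * q) * ((+ 2 + t) * ((+ 2 + t) * 1ℤ))
    regroup = solve-∀

  -- C(1+n , 3) = (n+1) n (n-1) / 6 is odd in n, so its even part is 0. Without this the term m = 1
  -- would carry only one factor p where p^2 is required.
  symmetrised-even-1 : ∀ t → symmetrised 2 1 t ≡ 0ℤ
  symmetrised-even-1 t = ℤ.*-cancelˡ-≡ (+ 6) _ _ (trans (factorial*symmetrised 2 0 t) (vanish (+ t)))
    where
    vanish : ∀ t → -1ℤ * ((+ 1 + t) * (+ 2 + t) * (+ 3 + t) * (1ℤ * 1ℤ - 1ℤ)) ≡ 0ℤ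
    vanish = solve-∀

  -- The source of the factor n^e in the result: (n² + n)/2 and (n² - n)/2 have difference n and sum
  -- n².
  symmetrised-0 : ∀ e → e ≡ 1 ⊎ e ≡ 2 → ∀ t → symmetrised e 0 t ≡ (+ 2 + + t) ^ e
  symmetrised-0 e e≡1⊎2 t = ℤ.*-cancelˡ-≡ (+ 2) _ _ (begin
    + 2 * (binom 2 (3 ℕ.+ t) + σ * (1ℤ * multichoose 2 t))
      ≡⟨ distrib (+ 2) (binom 2 (3 ℕ.+ t)) σ (multichoose 2 t) ⟩
    + 2 * binom 2 (3 ℕ.+ t) + σ * (+ 2 * multichoose 2 t)
      ≡⟨ cong₂ (λ x y → x + σ * y) (factorial*binom 2 (3 ℕ.+ t)) (factorial*multichoose 2 t) ⟩
    1ℤ * rising (- (+ 3 + + t)) 2 + σ * rising (1ℤ + + t) 2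
      ≡⟨ cases e e≡1⊎2 ⟩
    + 2 * (+ 2 + + t) ^ e ∎)
    where
    open ≡-Reasoning
    σ = -1ℤ ^ e
    distrib : ∀ f b σ m → f * (b + σ * (1ℤ * m)) ≡ f * b + σ * (f * m)
    distrib = solve-∀
    odd : ∀ t → 1ℤ * (1ℤ * (- (+ 3 + t) + 0ℤ) * (- (+ 3 + t) + 1ℤ)) + -1ℤ * (1ℤ * (1ℤ + t + 0ℤ) * (1ℤ + t + 1ℤ))
      ≡ + 2 * ((+ 2 + t) * 1ℤ)
    odd = solve-∀
    even : ∀ t → 1ℤ * (1ℤ * (- (+ 3 + t) + 0ℤ) * (- (+ 3 + t) + 1ℤ)) + 1ℤ * (1ℤ * (1ℤ + t + 0ℤ) * (1ℤ + t + 1ℤ))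
      ≡ + 2 * ((+ 2 + t) * ((+ 2 + t) * 1ℤ))
    even = solve-∀
    cases : ∀ e → e ≡ 1 ⊎ e ≡ 2 → 1ℤ * rising (- (+ 3 + + t)) 2 + -1ℤ ^ e * rising (1ℤ + + t) 2 ≡ + 2 * (+ 2 + + t) ^ e
    cases .1 (inj₁ refl) = odd (+ t)
    cases .2 (inj₂ refl) = even (+ t)

  4v<4+k⇒v≤k : ∀ v k → 4 ℕ.* v ℕ.+ 1 ℕ.≤ 4 ℕ.+ k → v ℕ.≤ k
  4v<4+k⇒v≤k v k bound = ℕ.≮⇒≥ λ k<v → ℕ.m+1+n≰m (4 ℕ.+ k) (begin
    4 ℕ.+ k ℕ.+ suc (3 ℕ.* k) ≡⟨ regroup k ⟩
    4 ℕ.* suc k ℕ.+ 1         ≤⟨ ℕ.+-monoˡ-≤ 1 (ℕ.*-monoʳ-≤ 4 k<v) ⟩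
    4 ℕ.* v ℕ.+ 1             ≤⟨ bound ⟩
    4 ℕ.+ k                   ∎)
    where
    open ℕ.≤-Reasoning
    regroup : ∀ k → 4 ℕ.+ k ℕ.+ (1 ℕ.+ 3 ℕ.* k) ≡ 4 ℕ.* (1 ℕ.+ k) ℕ.+ 1
    regroup = ℕSolver.solve-∀

  module _ {p : ℕ} (p-prime : Prime p) (5≤p : 5 ℕ.≤ p) where

    -- Multiplying `∣factorial*symmetrised` by p^e and by the surplus p^d turns (3+k)! = c p^v into
    -- c p^(k+1). Since p n is a power of p, the factor c prime to p can then be cancelled.
    prime^*symmetrised-≤ : ∀ {e} → e ≡ 1 ⊎ e ≡ 2 → ∀ R t → + 2 + + t ≡ (+ p) ^ R → ∀ k c v →
      ¬ p ℕ.∣ c → (3 ℕ.+ k) ! ≡ c ℕ.* p ℕ.^ v → e ℕ.+ v ℕ.≤ suc k →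
      (+ p * (+ 2 + + t)) ^ e ∣ (+ p) ^ suc k * symmetrised e (suc k) t
    prime^*symmetrised-≤ {e} e≡1⊎2 R t n≡pᴿ k c v p∤c factorial≡ e+v≤1+k =
      subst (_∣ P ^ suc k * X) (sym as-power) (prime^-cancel-∣ p-prime p∤c (suc R ℕ.* e) (P ^ suc k * X)
        (subst₂ _∣_ (trans (sym (^-distribʳ-* P N e)) as-power) reassemble
          (∣n⇒∣m*n (P ^ d) (*-monoʳ-∣ (P ^ e) (∣factorial*symmetrised e e≡1⊎2 k t)))))
      where
      open ≡-Reasoning
      P = + p
      N = + 2 + + t
      X = symmetrised e (suc k) t
      d = suc k ∸ (e ℕ.+ v)
      as-power : (P * N) ^ e ≡ P ^ (suc R ℕ.* e)
      as-power = trans (cong (λ x → (P * x) ^ e) n≡pᴿ) (ℤ.^-*-assoc P (suc R) e)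
      regroup : ∀ d e c v x → d * (e * (c * v * x)) ≡ c * (e * v * d * x)
      regroup = solve-∀
      reassemble : P ^ d * (P ^ e * (+ ((3 ℕ.+ k) !) * X)) ≡ + c * (P ^ suc k * X)
      reassemble = begin
        P ^ d * (P ^ e * (+ ((3 ℕ.+ k) !) * X))
          ≡⟨ cong (λ x → P ^ d * (P ^ e * (x * X))) (trans (cong +_ factorial≡) (trans (ℤ.pos-* c (p ℕ.^ v)) (cong (+ c *_) (pos-^ p v)))) ⟩
        P ^ d * (P ^ e * (+ c * P ^ v * X))
          ≡⟨ regroup (P ^ d) (P ^ e) (+ c) (P ^ v) X ⟩
        + c * (P ^ e * P ^ v * P ^ d * X)
          ≡⟨ cong (λ x → + c * (x * X)) (trans (cong (_* P ^ d) (sym (ℤ.^-distribˡ-+-* P e v))) (sym (ℤ.^-distribˡ-+-* P (e ℕ.+ v) d))) ⟩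
        + c * (P ^ (e ℕ.+ v ℕ.+ d) * X)
          ≡⟨ cong (λ x → + c * (P ^ x * X)) (ℕ.m+[n∸m]≡n e+v≤1+k) ⟩
        + c * (P ^ suc k * X) ∎

    prime^*symmetrised : ∀ {e} → e ≡ 1 ⊎ e ≡ 2 → ∀ R t → + 2 + + t ≡ (+ p) ^ R → ∀ k →
      (+ p * (+ 2 + + t)) ^ e ∣ (+ p) ^ suc k * symmetrised e (suc k) t
    prime^*symmetrised e≡1⊎2@(inj₁ refl) R t n≡pᴿ k
      with c , v , p∤c , factorial≡ , bound ← factorial-valuation p-prime 5≤p (3 ℕ.+ k) (s≤s z≤n)
      = prime^*symmetrised-≤ e≡1⊎2 R t n≡pᴿ k c v p∤c factorial≡
          (s≤s (4v<4+k⇒v≤k v k (ℕ.≤-trans bound (ℕ.n≤1+n _))))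
    -- The only case where e + v ≤ m fails: e = 2 and m = 1.
    prime^*symmetrised (inj₂ refl) R t n≡pᴿ zero = subst ((+ p * (+ 2 + + t)) ^ 2 ∣_) (sym
      (trans (cong ((+ p) ^ 1 *_) (symmetrised-even-1 t)) (ℤ.*-zeroʳ ((+ p) ^ 1)))) (divides 0ℤ refl)
    prime^*symmetrised e≡1⊎2@(inj₂ refl) R t n≡pᴿ (suc k)
      with c , v , p∤c , factorial≡ , bound ← factorial-valuation p-prime 5≤p (4 ℕ.+ k) (s≤s z≤n)
      = prime^*symmetrised-≤ e≡1⊎2 R t n≡pᴿ (suc k) c v p∤c factorial≡ (s≤s (s≤s (4v<4+k⇒v≤k v k bound)))

  -- Fermat's and Euler's theorems, inverses as powers

  binomial-theorem : ∀ x n → (1ℤ + x) ^ n ≡ ∑ (suc n) (λ k → binom k n * x ^ k)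
  binomial-theorem x zero    = refl
  binomial-theorem x (suc n) = sym (begin
    1ℤ * 1ℤ + ∑ (suc n) (λ k → binom (suc k) (suc n) * (x * x ^ k))
      ≡⟨ cong (λ s → 1ℤ * 1ℤ + s) (trans
           (∑-cong (suc n) (λ k _ → trans (cong (_* (x * x ^ k)) (binom-suc-suc k n)) (expand (binom k n) (binom (suc k) n) x (x ^ k))))
           (∑-lin (suc n) x (λ k → binom k n * x ^ k) (λ k → binom (suc k) n * (x * x ^ k)))) ⟩
    1ℤ * 1ℤ + (x * S + ∑ (suc n) (λ k → binom (suc k) n * (x * x ^ k)))
      ≡⟨ regroup x S (∑ (suc n) (λ k → binom (suc k) n * (x * x ^ k))) ⟩
    x * S + ∑ (suc (suc n)) (λ k → binom k n * x ^ k)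
      ≡⟨ cong (λ s → x * S + s) (∑-last (suc n) (λ k → binom k n * x ^ k)) ⟩
    x * S + (S + binom (suc n) n * x ^ suc n)
      ≡⟨ cong (λ b → x * S + (S + + b * x ^ suc n)) (k>n⇒nCk≡0 (ℕ.n<1+n n)) ⟩
    x * S + (S + 0ℤ * x ^ suc n)
      ≡⟨ collect x S (x ^ suc n) ⟩
    (1ℤ + x) * S
      ≡⟨ cong ((1ℤ + x) *_) (binomial-theorem x n) ⟨
    (1ℤ + x) * (1ℤ + x) ^ n ∎)
    where
    open ≡-Reasoning
    S = ∑ (suc n) (λ k → binom k n * x ^ k)
    expand : ∀ a b x y → (a + b) * (x * y) ≡ x * (a * y) + b * (x * y)
    expand = solve-∀
    regroup : ∀ x s u → 1ℤ * 1ℤ + (x * s + u) ≡ x * s + (1ℤ * 1ℤ + u)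
    regroup = solve-∀
    collect : ∀ x s y → x * s + (s + 0ℤ * y) ≡ (1ℤ + x) * s
    collect = solve-∀

  -- Absorption expresses (k+1) C(p , k+1) through C(p , k), and k + 1 < p is prime to p. Only the
  -- first coefficient C(p , 1) = p is computed directly.
  prime∣binom : ∀ {p} → Prime p → ∀ k → suc k ℕ.< p → + p ∣ binom (suc k) p
  prime∣binom {p} p-prime zero    _ = divides 1ℤ (begin
    binom 1 p          ≡⟨ ℤ.*-identityˡ (binom 1 p) ⟨
    1ℤ * binom 1 p     ≡⟨ binom-absorption 0 p ⟩
    (+ p - 0ℤ) * 1ℤ    ≡⟨ simp (+ p) ⟩
    1ℤ * + p           ∎)
    where
    open ≡-Reasoning
    simp : ∀ p → (p - 0ℤ) * 1ℤ ≡ 1ℤ * p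
    simp = solve-∀
  prime∣binom {p} p-prime (suc k) 2+k<p
    with euclid p-prime (+ (2 ℕ.+ k)) (binom (2 ℕ.+ k) p)
      (subst (+ p ∣_) (sym (binom-absorption (suc k) p))
        (∣n⇒∣m*n (+ p - + suc k) (prime∣binom p-prime k (ℕ.<-trans (ℕ.n<1+n (suc k)) 2+k<p))))
  ... | inj₁ p∣2+k = contradiction (∣⇒∣ᵤ p∣2+k) (p∤0<m<p (s≤s z≤n) 2+k<p)
  ... | inj₂ p∣binom = p∣binom

  prime∣[1+x]^p : ∀ {p} → Prime p → ∀ x → + p ∣ (1ℤ + x) ^ p - (1ℤ + x ^ p)
  prime∣[1+x]^p {suc p-1} p-prime x = subst (+ p ∣_) (sym middle) (∑-∣ p-1 (λ k k<p-1 →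
    ∣m⇒∣m*n (x ^ suc k) (prime∣binom p-prime k (s≤s k<p-1))))
    where
    open ≡-Reasoning
    p = suc p-1
    f = λ k → binom k p * x ^ k
    M = ∑ p-1 (f ∘ suc)
    cancel : ∀ m y → 1ℤ * 1ℤ + (m + 1ℤ * y) - (1ℤ + y) ≡ m
    cancel = solve-∀
    middle : (1ℤ + x) ^ p - (1ℤ + x ^ p) ≡ M
    middle = begin
      (1ℤ + x) ^ p - (1ℤ + x ^ p)
        ≡⟨ cong (_- (1ℤ + x ^ p)) (binomial-theorem x p) ⟩
      1ℤ * 1ℤ + ∑ p (f ∘ suc) - (1ℤ + x ^ p)
        ≡⟨ cong (λ s → 1ℤ * 1ℤ + s - (1ℤ + x ^ p)) (∑-last p-1 (f ∘ suc)) ⟩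
      1ℤ * 1ℤ + (M + + (p C p) * x ^ p) - (1ℤ + x ^ p)
        ≡⟨ cong (λ b → 1ℤ * 1ℤ + (M + + b * x ^ p) - (1ℤ + x ^ p)) (nCn≡1 p) ⟩
      1ℤ * 1ℤ + (M + 1ℤ * x ^ p) - (1ℤ + x ^ p)
        ≡⟨ cancel M (x ^ p) ⟩
      M ∎

  fermat : ∀ {p} → Prime p → ∀ a → + p ∣ (+ a) ^ p - + a
  fermat {suc p-1} p-prime zero = divides 0ℤ refl
  fermat {p} p-prime (suc a) = subst (+ p ∣_) (telescope ((+ suc a) ^ p) ((+ a) ^ p) (+ a))
    (∣m∣n⇒∣m+n (prime∣[1+x]^p p-prime (+ a)) (fermat p-prime a))
    where
    telescope : ∀ x y a → x - (1ℤ + y) + (y - a) ≡ x - (1ℤ + a)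
    telescope = solve-∀

  fermat-unit : ∀ {p} → Prime p → ∀ {a} → ¬ p ℕ.∣ a → + p ∣ (+ a) ^ (p ∸ 1) - 1ℤ
  fermat-unit {p@(suc p-1)} p-prime {a} p∤a = [ (λ p∣a → contradiction (∣⇒∣ᵤ p∣a) p∤a) , id ]′
    (euclid p-prime (+ a) ((+ a) ^ p-1 - 1ℤ) (subst (+ p ∣_) (factor (+ a) ((+ a) ^ p-1)) (fermat p-prime a)))
    where
    factor : ∀ a x → a * x - a ≡ a * (x - 1ℤ)
    factor = solve-∀

  geometric : ∀ x n → x ^ n - 1ℤ ≡ (x - 1ℤ) * ∑ n (x ^_)
  geometric x zero    = sym (ℤ.*-zeroʳ (x - 1ℤ))
  geometric x (suc n) = begin
    x * x ^ n - 1ℤ                          ≡⟨ split x (x ^ n) ⟩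
    x ^ n - 1ℤ + (x - 1ℤ) * x ^ n           ≡⟨ cong (_+ (x - 1ℤ) * x ^ n) (geometric x n) ⟩
    (x - 1ℤ) * ∑ n (x ^_) + (x - 1ℤ) * x ^ n ≡⟨ ℤ.*-distribˡ-+ (x - 1ℤ) (∑ n (x ^_)) (x ^ n) ⟨
    (x - 1ℤ) * (∑ n (x ^_) + x ^ n)         ≡⟨ cong ((x - 1ℤ) *_) (∑-last n (x ^_)) ⟨
    (x - 1ℤ) * ∑ (suc n) (x ^_)             ∎
    where
    open ≡-Reasoning
    split : ∀ x y → x * y - 1ℤ ≡ y - 1ℤ + (x - 1ℤ) * y
    split = solve-∀

  ∣x-1⇒∣x^n-1 : ∀ {d x} → d ∣ x - 1ℤ → ∀ n → d ∣ x ^ n - 1ℤ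
  ∣x-1⇒∣x^n-1 {d} {x} d∣x-1 n = subst (d ∣_) (sym (geometric x n)) (∣m⇒∣m*n (∑ n (x ^_)) d∣x-1)

  ∣x-1⇒∣∑-n : ∀ {d x} → d ∣ x - 1ℤ → ∀ n → d ∣ ∑ n (x ^_) - + n
  ∣x-1⇒∣∑-n d∣x-1 zero = divides 0ℤ refl
  ∣x-1⇒∣∑-n {d} {x} d∣x-1 (suc n) = subst (d ∣_)
    (trans (regroup (∑ n (x ^_)) (x ^ n) (+ n)) (cong (_- + suc n) (sym (∑-last n (x ^_)))))
    (∣m∣n⇒∣m+n (∣x-1⇒∣∑-n d∣x-1 n) (∣x-1⇒∣x^n-1 d∣x-1 n))
    where
    regroup : ∀ s y n → s - n + (y - 1ℤ) ≡ s + y - (1ℤ + n)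
    regroup = solve-∀

  -- In x^p - 1 = (x - 1)(1 + x + ... + x^(p-1)) the second factor is congruent to p, hence to 0,
  -- modulo p, because x ≡ 1 there.
  lift-∣x^p-1 : ∀ p k {x} → (+ p) ^ suc k ∣ x - 1ℤ → (+ p) ^ suc (suc k) ∣ x ^ p - 1ℤ
  lift-∣x^p-1 p k {x} pᵏ∣x-1
    with divides q eq ← pᵏ∣x-1
       | divides r eq′ ← ∣m+n∣n⇒∣m {+ p} {∑ p (x ^_)} {n = - + p}
           (∣x-1⇒∣∑-n {+ p} {x} (∣-trans (∣m⇒∣m*n ((+ p) ^ k) ∣-refl) pᵏ∣x-1) p) (∣m⇒∣-m ∣-refl)
    = divides (q * r) (trans (geometric x p) (trans (cong₂ _*_ eq eq′) (regroup q r (+ p) ((+ p) ^ suc k))))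
    where
    regroup : ∀ q r p y → q * y * (r * p) ≡ q * r * (p * y)
    regroup = solve-∀

  euler : ∀ {p} → Prime p → ∀ {a} → ¬ p ℕ.∣ a → ∀ k → (+ p) ^ suc k ∣ (+ a) ^ ((p ∸ 1) ℕ.* p ℕ.^ k) - 1ℤ
  euler {p} p-prime {a} p∤a zero = subst₂ (λ q m → q ∣ (+ a) ^ m - 1ℤ)
    (sym (ℤ.*-identityʳ (+ p))) (sym (ℕ.*-identityʳ (p ∸ 1))) (fermat-unit p-prime p∤a)
  euler {p} p-prime {a} p∤a (suc k) = subst (λ x → (+ p) ^ suc (suc k) ∣ x - 1ℤ)
    (trans (ℤ.^-*-assoc (+ a) ((p ∸ 1) ℕ.* p ℕ.^ k) p) (cong ((+ a) ^_) (regroup (p ∸ 1) p (p ℕ.^ k))))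
    (lift-∣x^p-1 p k (euler p-prime p∤a k))
    where
    regroup : ∀ m p q → m ℕ.* q ℕ.* p ≡ m ℕ.* (p ℕ.* q)
    regroup = ℕSolver.solve-∀

  -- With φ = (p-1) p^k and t = φ - 1 the two exponents add up to 2 φ s. Doubling φ makes the
  -- inverting exponent s (2φ - 1) an odd multiple of s, which preserves parity; t depends neither
  -- on a nor on s.
  inverse-power : ∀ {p} → Prime p → ∀ k → ∃[ t ] (∀ {a} → ¬ p ℕ.∣ a → ∀ s → (+ p) ^ suc k ∣ (+ a) ^ s * (+ a) ^ (s ℕ.* suc (2 ℕ.* t)) - 1ℤ)
  inverse-power {p} p-prime k = ℕ.pred φ , λ {a} p∤a s → subst (λ x → (+ p) ^ suc k ∣ x - 1ℤ)
    (begin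
      ((+ a) ^ φ) ^ (2 ℕ.* s)                                       ≡⟨ ℤ.^-*-assoc (+ a) φ (2 ℕ.* s) ⟩
      (+ a) ^ (φ ℕ.* (2 ℕ.* s))                                     ≡⟨ cong (λ m → (+ a) ^ (m ℕ.* (2 ℕ.* s))) (ℕ.suc-pred φ) ⟨
      (+ a) ^ (suc (ℕ.pred φ) ℕ.* (2 ℕ.* s))                        ≡⟨ cong ((+ a) ^_) (split (ℕ.pred φ) s) ⟩
      (+ a) ^ (s ℕ.+ s ℕ.* suc (2 ℕ.* ℕ.pred φ))                    ≡⟨ ℤ.^-distribˡ-+-* (+ a) s _ ⟩
      (+ a) ^ s * (+ a) ^ (s ℕ.* suc (2 ℕ.* ℕ.pred φ))              ∎)
    (∣x-1⇒∣x^n-1 (euler p-prime p∤a k) (2 ℕ.* s))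
    where
    open ≡-Reasoning
    φ = (p ∸ 1) ℕ.* p ℕ.^ k
    instance
      _ = prime⇒nonZero p-prime
      _ = ℕ.>-nonZero (ℕ.m<n⇒0<n∸m (ℕ.nonTrivial⇒n>1 p {{prime⇒nonTrivial p-prime}}))
      _ = ℕ.m^n≢0 p k
      _ = ℕ.m*n≢0 (p ∸ 1) (p ℕ.^ k)
    split : ∀ t s → (1 ℕ.+ t) ℕ.* (2 ℕ.* s) ≡ s ℕ.+ s ℕ.* (1 ℕ.+ 2 ℕ.* t)
    split = ℕSolver.solve-∀

  -- Newton expansions

  -- Newton p f g: f x and g y are the values at x and at -1 - y of one integral
  -- combination of the polynomials p^l C(x , l).
  data Newton (p : ℕ) : Seq → Seq → Set where
    basis : ∀ l → Newton p (λ x → (+ p) ^ l * binom l x) (λ y → (- + p) ^ l * multichoose l y)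
    lin   : ∀ c {f f′ g g′} → Newton p f g → Newton p f′ g′ → Newton p (λ x → c * f x + f′ x) (λ y → c * g y + g′ y)
    ext   : ∀ {f f′ g g′} → (∀ x → f x ≡ f′ x) → (∀ y → g y ≡ g′ y) → Newton p f g → Newton p f′ g′

  -- Since x C(x , l) = (l+1) C(x , l+1) + l C(x , l), the p in front of x is exactly what raises
  -- p^l to p^(l+1). The second multiplier is a + p x at x = -1 - y.
  Newton-* : ∀ {p} a {f g} → Newton p f g → Newton p (λ x → (a + + p * + x) * f x) (λ y → (a - + p - + p * + y) * g y)
  -- The coefficient of the l-th basis element is a + p l; `lin` adds its last summand with
  -- coefficient 1, hence the - 1.
  Newton-* {p} a (basis l) = ext expand⁺ expand⁻ (lin (+ suc l) (basis (suc l)) (lin (a + P * + l - 1ℤ) (basis l) (basis l)))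
    where
    open ≡-Reasoning
    P = + p
    factor⁺ : ∀ a P q l x b b′ → l * (P * q * b′) + ((a + P * x - 1ℤ) * (q * b) + q * b) ≡ P * q * (l * b′) + (a + P * x) * (q * b)
    factor⁺ = solve-∀
    collect⁺ : ∀ a P q l x b → P * q * ((x - l) * b) + (a + P * l) * (q * b) ≡ (a + P * x) * (q * b)
    collect⁺ = solve-∀
    expand⁺ : ∀ x → + suc l * (P ^ suc l * binom (suc l) x) + ((a + P * + l - 1ℤ) * (P ^ l * binom l x) + P ^ l * binom l x)
      ≡ (a + P * + x) * (P ^ l * binom l x)
    expand⁺ x = begin
      _ ≡⟨ factor⁺ a P (P ^ l) (+ suc l) (+ l) (binom l x) (binom (suc l) x) ⟩
      P * P ^ l * (+ suc l * binom (suc l) x) + (a + P * + l) * (P ^ l * binom l x)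
        ≡⟨ cong (λ b → P * P ^ l * b + (a + P * + l) * (P ^ l * binom l x)) (binom-absorption l x) ⟩
      P * P ^ l * ((+ x - + l) * binom l x) + (a + P * + l) * (P ^ l * binom l x)
        ≡⟨ collect⁺ a P (P ^ l) (+ l) (+ x) (binom l x) ⟩
      (a + P * + x) * (P ^ l * binom l x) ∎
    factor⁻ : ∀ a P q l x b b′ → l * (- P * q * b′) + ((a + P * x - 1ℤ) * (q * b) + q * b) ≡ - P * q * (l * b′) + (a + P * x) * (q * b)
    factor⁻ = solve-∀
    collect⁻ : ∀ a P q l y b → - P * q * ((1ℤ + y + l) * b) + (a + P * l) * (q * b) ≡ (a - P - P * y) * (q * b)
    collect⁻ = solve-∀
    expand⁻ : ∀ y → + suc l * ((- P) ^ suc l * multichoose (suc l) y) + ((a + P * + l - 1ℤ) * ((- P) ^ l * multichoose l y) + (- P) ^ l * multichoose l y)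
      ≡ (a - P - P * + y) * ((- P) ^ l * multichoose l y)
    expand⁻ y = begin
      _ ≡⟨ factor⁻ a P ((- P) ^ l) (+ suc l) (+ l) (multichoose l y) (multichoose (suc l) y) ⟩
      - P * (- P) ^ l * (+ suc l * multichoose (suc l) y) + (a + P * + l) * ((- P) ^ l * multichoose l y)
        ≡⟨ cong (λ b → - P * (- P) ^ l * b + (a + P * + l) * ((- P) ^ l * multichoose l y)) (multichoose-absorption l y) ⟩
      - P * (- P) ^ l * ((+ suc y + + l) * multichoose l y) + (a + P * + l) * ((- P) ^ l * multichoose l y)
        ≡⟨ collect⁻ a P ((- P) ^ l) (+ l) (+ y) (multichoose l y) ⟩
      (a - P - P * + y) * ((- P) ^ l * multichoose l y) ∎
  Newton-* {p} a (lin c {f} {f′} {g} {g′} F F′) =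
    ext (λ x → distrib c (a + + p * + x) (f x) (f′ x)) (λ y → distrib c (a - + p - + p * + y) (g y) (g′ y))
      (lin c (Newton-* a F) (Newton-* a F′))
    where
    distrib : ∀ c m u v → c * (m * u) + m * v ≡ m * (c * u + v)
    distrib = solve-∀
  Newton-* {p} a (ext f≡f′ g≡g′ F) =
    ext (λ x → cong ((a + + p * + x) *_) (f≡f′ x)) (λ y → cong ((a - + p - + p * + y) *_) (g≡g′ y)) (Newton-* a F)

  Newton-^ : ∀ {p} a s → Newton p (λ x → (a + + p * + x) ^ s) (λ y → (a - + p - + p * + y) ^ s)
  Newton-^ a zero    = ext (λ _ → refl) (λ _ → refl) (basis 0)
  Newton-^ a (suc s) = Newton-* a (Newton-^ a s)

  -- Induction over the expansion: for a functional that is linear in the pair of sequences jointly,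
  -- divisibility needs to be checked on basis pairs alone.
  Newton-∣ : ∀ {p d} (Φ : Seq → Seq → ℤ) →
    (∀ c f f′ g g′ → Φ (λ x → c * f x + f′ x) (λ y → c * g y + g′ y) ≡ c * Φ f g + Φ f′ g′) →
    (∀ {f f′ g g′} → (∀ x → f x ≡ f′ x) → (∀ y → g y ≡ g′ y) → Φ f g ≡ Φ f′ g′) →
    (∀ l → d ∣ Φ (λ x → (+ p) ^ l * binom l x) (λ y → (- + p) ^ l * multichoose l y)) →
    ∀ {f g} → Newton p f g → d ∣ Φ f g
  Newton-∣ Φ Φ-lin Φ-cong d∣basis (basis l) = d∣basis l
  Newton-∣ {d = d} Φ Φ-lin Φ-cong d∣basis (lin c {f} {f′} {g} {g′} F F′) = subst (d ∣_) (sym (Φ-lin c f f′ g g′))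
    (∣m∣n⇒∣m+n (∣n⇒∣m*n c (Newton-∣ Φ Φ-lin Φ-cong d∣basis F)) (Newton-∣ Φ Φ-lin Φ-cong d∣basis F′))
  Newton-∣ {d = d} Φ Φ-lin Φ-cong d∣basis (ext f≡f′ g≡g′ F) =
    subst (d ∣_) (Φ-cong f≡f′ g≡g′) (Newton-∣ Φ Φ-lin Φ-cong d∣basis F)

  ⋆⋆-scale : ∀ a b c (f g h : Seq) n →
    ((λ x → a * f x) ⋆ ((λ x → b * g x) ⋆ (λ x → c * h x))) n ≡ a * (b * c) * (f ⋆ (g ⋆ h)) n
  ⋆⋆-scale a b c f g h n = trans (⋆-congʳ (λ x → a * f x) (⋆-scale b c g h) n) (⋆-scale a (b * c) f (g ⋆ h) n)

  -- The difference between the sum over k₁ + k₂ + k₃ = pn with k₁ , k₂ , k₃ in given classes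
  -- ±a , ±b , ±c mod p, a + b + c = p, and n^e times the corresponding term for n = 1; here n = 2 + t.
  defect : ℕ → ℕ → (f f⁻ g g⁻ h h⁻ : Seq) → ℤ
  defect e t f f⁻ g g⁻ h h⁻ =
    (f ⋆ (g ⋆ h)) (suc t) + -1ℤ ^ e * (f⁻ ⋆ (g⁻ ⋆ h⁻)) t - (+ 2 + + t) ^ e * (f 0 * (g 0 * h 0))

  module _ {p : ℕ} (p-prime : Prime p) (5≤p : 5 ℕ.≤ p) {e : ℕ} (e≡1⊎2 : e ≡ 1 ⊎ e ≡ 2) where

    private
      P = + p
      b⁺ b⁻ : ℕ → Seq
      b⁺ l x = P ^ l * binom l x
      b⁻ l y = (- P) ^ l * multichoose l y

    -- On basis triples the convolution identities leave only the sum m of the three indices, so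
    -- that both kinds of classes merge into one symmetrised binomial.
    basis-defect : ∀ t i j k → let m = i ℕ.+ (j ℕ.+ k) in
      defect e t (b⁺ i) (b⁻ i) (b⁺ j) (b⁻ j) (b⁺ k) (b⁻ k)
        ≡ P ^ m * symmetrised e m t - (+ 2 + + t) ^ e * (b⁺ i 0 * (b⁺ j 0 * b⁺ k 0))
    basis-defect t i j k = cong (_- (+ 2 + + t) ^ e * (b⁺ i 0 * (b⁺ j 0 * b⁺ k 0))) (begin
      (b⁺ i ⋆ (b⁺ j ⋆ b⁺ k)) (suc t) + σ * (b⁻ i ⋆ (b⁻ j ⋆ b⁻ k)) t
        ≡⟨ cong₂ (λ x y → x + σ * y)
             (trans (⋆⋆-scale (P ^ i) (P ^ j) (P ^ k) (binom i) (binom j) (binom k) (suc t))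
                    (cong₂ _*_ (combine P) (binom-⋆-⋆ i j k (suc t))))
             (trans (⋆⋆-scale ((- P) ^ i) ((- P) ^ j) ((- P) ^ k) (multichoose i) (multichoose j) (multichoose k) t)
                    (cong₂ _*_ (trans (combine (- P)) (^-neg P m)) (multichoose-⋆-⋆ i j k t))) ⟩
      P ^ m * binom (2 ℕ.+ m) (3 ℕ.+ t) + σ * (-1ℤ ^ m * P ^ m * multichoose (2 ℕ.+ m) t)
        ≡⟨ factor (P ^ m) (binom (2 ℕ.+ m) (3 ℕ.+ t)) σ (-1ℤ ^ m) (multichoose (2 ℕ.+ m) t) ⟩
      P ^ m * symmetrised e m t ∎)
      where
      open ≡-Reasoning
      m = i ℕ.+ (j ℕ.+ k)
      σ = -1ℤ ^ e
      combine : ∀ x → x ^ i * (x ^ j * x ^ k) ≡ x ^ m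
      combine x = sym (trans (ℤ.^-distribˡ-+-* x i (j ℕ.+ k)) (cong (x ^ i *_) (ℤ.^-distribˡ-+-* x j k)))
      factor : ∀ q b σ s c → q * b + σ * (s * q * c) ≡ q * (b + σ * (s * c))
      factor = solve-∀

    -- A positive index makes the product of values at 0 vanish, as C(0 , l) = 0 for l > 0, and
    -- `prime^*symmetrised` applies. If all indices are 0, the two sides cancel exactly by
    -- `symmetrised-0`.
    ∣basis-defect : ∀ R t → + 2 + + t ≡ P ^ R → ∀ i j k →
      (P * (+ 2 + + t)) ^ e ∣ defect e t (b⁺ i) (b⁻ i) (b⁺ j) (b⁻ j) (b⁺ k) (b⁻ k)
    ∣basis-defect R t n≡pᴿ i j k = subst (Q ∣_) (sym (basis-defect t i j k)) (cases i j k)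
      where
      Q = (P * (+ 2 + + t)) ^ e
      N = (+ 2 + + t) ^ e
      drop : ∀ y {z} → z ≡ 0ℤ → y - N * z ≡ y
      drop y refl = trans (cong (λ z → y - z) (ℤ.*-zeroʳ N)) (ℤ.+-identityʳ y)
      cases : ∀ i j k → let m = i ℕ.+ (j ℕ.+ k) in
        Q ∣ P ^ m * symmetrised e m t - N * (b⁺ i 0 * (b⁺ j 0 * b⁺ k 0))
      cases zero zero zero = subst (Q ∣_) (sym (trans (cong (λ x → 1ℤ * x - N * 1ℤ) (symmetrised-0 e e≡1⊎2 t)) (cancel N)))
        (divides 0ℤ refl)
        where
        cancel : ∀ x → 1ℤ * x - x * 1ℤ ≡ 0ℤ
        cancel = solve-∀
      cases zero zero (suc k) = subst (Q ∣_) (sym (drop _ (vanish (P ^ suc k))))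
        (prime^*symmetrised p-prime 5≤p e≡1⊎2 R t n≡pᴿ k)
        where
        vanish : ∀ x → 1ℤ * 1ℤ * (1ℤ * 1ℤ * (x * 0ℤ)) ≡ 0ℤ
        vanish = solve-∀
      cases zero (suc j) k = subst (Q ∣_) (sym (drop _ (vanish (P ^ suc j) (b⁺ k 0))))
        (prime^*symmetrised p-prime 5≤p e≡1⊎2 R t n≡pᴿ (j ℕ.+ k))
        where
        vanish : ∀ x y → 1ℤ * 1ℤ * (x * 0ℤ * y) ≡ 0ℤ
        vanish = solve-∀
      cases (suc i) j k = subst (Q ∣_) (sym (drop _ (vanish (P ^ suc i) (b⁺ j 0 * b⁺ k 0))))
        (prime^*symmetrised p-prime 5≤p e≡1⊎2 R t n≡pᴿ (i ℕ.+ (j ℕ.+ k)))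
        where
        vanish : ∀ x y → x * 0ℤ * y ≡ 0ℤ
        vanish = solve-∀

    -- The defect is trilinear in the three pairs, so each pair is expanded in turn while the other
    -- two are held fixed.
    ∣defect : ∀ R t → + 2 + + t ≡ P ^ R → ∀ {f f⁻ g g⁻ h h⁻} → Newton p f f⁻ → Newton p g g⁻ → Newton p h h⁻ →
      (P * (+ 2 + + t)) ^ e ∣ defect e t f f⁻ g g⁻ h h⁻
    ∣defect R t n≡pᴿ {f} {f⁻} {g} {g⁻} {h} {h⁻} F G H =
      Newton-∣ (λ f f⁻ → defect e t f f⁻ g g⁻ h h⁻) (lin₁ g g⁻ h h⁻) (cong₁ g g⁻ h h⁻) (λ i →
      Newton-∣ (λ g g⁻ → defect e t (b⁺ i) (b⁻ i) g g⁻ h h⁻) (lin₂ (b⁺ i) (b⁻ i) h h⁻) (cong₂′ (b⁺ i) (b⁻ i) h h⁻) (λ j →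
      Newton-∣ (λ h h⁻ → defect e t (b⁺ i) (b⁻ i) (b⁺ j) (b⁻ j) h h⁻) (lin₃ (b⁺ i) (b⁻ i) (b⁺ j) (b⁻ j)) (cong₃ (b⁺ i) (b⁻ i) (b⁺ j) (b⁻ j))
        (∣basis-defect R t n≡pᴿ i j) H) G) F
      where
      σ = -1ℤ ^ e
      N = (+ 2 + + t) ^ e
      defect-≡ : ∀ {a a′ b b′ c c′} → a ≡ a′ → b ≡ b′ → c ≡ c′ → a + σ * b - N * c ≡ a′ + σ * b′ - N * c′
      defect-≡ refl refl refl = refl
      combine : ∀ c σ N a a′ b b′ z z′ → c * a + a′ + σ * (c * b + b′) - N * (c * z + z′) ≡ c * (a + σ * b - N * z) + (a′ + σ * b′ - N * z′)
      combine = solve-∀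
      lin₁ : ∀ g g⁻ h h⁻ c f f′ u u′ → defect e t (λ x → c * f x + f′ x) (λ y → c * u y + u′ y) g g⁻ h h⁻
        ≡ c * defect e t f u g g⁻ h h⁻ + defect e t f′ u′ g g⁻ h h⁻
      lin₁ g g⁻ h h⁻ c f f′ u u′ = trans
        (defect-≡ (⋆-linˡ c f f′ (g ⋆ h) (suc t)) (⋆-linˡ c u u′ (g⁻ ⋆ h⁻) t) (distrib c (f 0) (f′ 0) (g 0 * h 0)))
        (combine c σ N _ _ _ _ (f 0 * (g 0 * h 0)) (f′ 0 * (g 0 * h 0)))
        where
        distrib : ∀ c a b z → (c * a + b) * z ≡ c * (a * z) + b * z
        distrib = solve-∀
      lin₂ : ∀ f f⁻ h h⁻ c g g′ u u′ → defect e t f f⁻ (λ x → c * g x + g′ x) (λ y → c * u y + u′ y) h h⁻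
        ≡ c * defect e t f f⁻ g u h h⁻ + defect e t f f⁻ g′ u′ h h⁻
      lin₂ f f⁻ h h⁻ c g g′ u u′ = trans
        (defect-≡ (trans (⋆-congʳ f (⋆-linˡ c g g′ h) (suc t)) (⋆-linʳ c f (g ⋆ h) (g′ ⋆ h) (suc t)))
                  (trans (⋆-congʳ f⁻ (⋆-linˡ c u u′ h⁻) t) (⋆-linʳ c f⁻ (u ⋆ h⁻) (u′ ⋆ h⁻) t))
                  (distrib c (f 0) (g 0) (g′ 0) (h 0)))
        (combine c σ N _ _ _ _ (f 0 * (g 0 * h 0)) (f 0 * (g′ 0 * h 0)))
        where
        distrib : ∀ c x a b z → x * ((c * a + b) * z) ≡ c * (x * (a * z)) + x * (b * z)
        distrib = solve-∀
      lin₃ : ∀ f f⁻ g g⁻ c h h′ u u′ → defect e t f f⁻ g g⁻ (λ x → c * h x + h′ x) (λ y → c * u y + u′ y)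
        ≡ c * defect e t f f⁻ g g⁻ h u + defect e t f f⁻ g g⁻ h′ u′
      lin₃ f f⁻ g g⁻ c h h′ u u′ = trans
        (defect-≡ (trans (⋆-congʳ f (⋆-linʳ c g h h′) (suc t)) (⋆-linʳ c f (g ⋆ h) (g ⋆ h′) (suc t)))
                  (trans (⋆-congʳ f⁻ (⋆-linʳ c g⁻ u u′) t) (⋆-linʳ c f⁻ (g⁻ ⋆ u) (g⁻ ⋆ u′) t))
                  (distrib c (f 0) (g 0) (h 0) (h′ 0)))
        (combine c σ N _ _ _ _ (f 0 * (g 0 * h 0)) (f 0 * (g 0 * h′ 0)))
        where
        distrib : ∀ c x y a b → x * (y * (c * a + b)) ≡ c * (x * (y * a)) + x * (y * b)
        distrib = solve-∀
      cong₁ : ∀ g g⁻ h h⁻ {f f′ u u′ : Seq} → (∀ x → f x ≡ f′ x) → (∀ y → u y ≡ u′ y) →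
        defect e t f u g g⁻ h h⁻ ≡ defect e t f′ u′ g g⁻ h h⁻
      cong₁ g g⁻ h h⁻ f≡f′ u≡u′ = defect-≡ (⋆-congˡ (g ⋆ h) f≡f′ (suc t)) (⋆-congˡ (g⁻ ⋆ h⁻) u≡u′ t)
        (cong (_* (g 0 * h 0)) (f≡f′ 0))
      cong₂′ : ∀ f f⁻ h h⁻ {g g′ u u′ : Seq} → (∀ x → g x ≡ g′ x) → (∀ y → u y ≡ u′ y) →
        defect e t f f⁻ g u h h⁻ ≡ defect e t f f⁻ g′ u′ h h⁻
      cong₂′ f f⁻ h h⁻ g≡g′ u≡u′ = defect-≡
        (⋆-congʳ f (⋆-congˡ h g≡g′) (suc t)) (⋆-congʳ f⁻ (⋆-congˡ h⁻ u≡u′) t)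
        (cong (λ x → f 0 * (x * h 0)) (g≡g′ 0))
      cong₃ : ∀ f f⁻ g g⁻ {h h′ u u′ : Seq} → (∀ x → h x ≡ h′ x) → (∀ y → u y ≡ u′ y) →
        defect e t f f⁻ g g⁻ h u ≡ defect e t f f⁻ g g⁻ h′ u′
      cong₃ f f⁻ g g⁻ h≡h′ u≡u′ = defect-≡
        (⋆-congʳ f (⋆-congʳ g h≡h′) (suc t)) (⋆-congʳ f⁻ (⋆-congʳ g⁻ u≡u′) t)
        (cong (λ x → f 0 * (g 0 * x)) (h≡h′ 0))

  -- Splitting a convolution by residues

  -- Multiplication of the generating function by its variable. It records a carry: when two
  -- residues overflow p, the quotients have one unit less to share, and none are left for n = 0.
  shift : Seq → Seq
  shift f zero    = 0ℤ
  shift f (suc n) = f n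

  residue : ℕ → ℕ → Seq → Seq
  residue p a f x = f (a ℕ.+ p ℕ.* x)

  ⋆-shift : ∀ (f g : Seq) n → (f ⋆ shift g) n ≡ shift (f ⋆ g) n
  ⋆-shift f g zero    = trans (⋆-0 f (shift g)) (ℤ.*-zeroʳ (f 0))
  ⋆-shift f g (suc n) = trans (⋆-last f (shift g) n) (x+y*0≡x _ (f (suc n)))

  ⋆-zeroˡ : ∀ {f : Seq} (g : Seq) → (∀ x → f x ≡ 0ℤ) → ∀ n → (f ⋆ g) n ≡ 0ℤ
  ⋆-zeroˡ {f} g f≡0 n = begin
    (f ⋆ g) n                      ≡⟨ ⋆-congˡ g (λ x → trans (f≡0 x) (sym (ℤ.*-zeroˡ (f x)))) n ⟩
    ((λ x → 0ℤ * f x) ⋆ g) n       ≡⟨ ⋆-congʳ (λ x → 0ℤ * f x) (λ x → sym (ℤ.*-identityˡ (g x))) n ⟩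
    ((λ x → 0ℤ * f x) ⋆ (λ x → 1ℤ * g x)) n ≡⟨ ⋆-scale 0ℤ 1ℤ f g n ⟩
    0ℤ * (f ⋆ g) n                 ≡⟨ ℤ.*-zeroˡ ((f ⋆ g) n) ⟩
    0ℤ                             ∎
    where open ≡-Reasoning

  ⋆-zeroʳ : ∀ (f : Seq) {g : Seq} → (∀ x → g x ≡ 0ℤ) → ∀ n → (f ⋆ g) n ≡ 0ℤ
  ⋆-zeroʳ f {g} g≡0 n = begin
    (f ⋆ g) n                      ≡⟨ ⋆-congʳ f (λ x → trans (g≡0 x) (sym (ℤ.*-zeroˡ (g x)))) n ⟩
    (f ⋆ (λ x → 0ℤ * g x)) n       ≡⟨ ⋆-congˡ (λ x → 0ℤ * g x) (λ x → sym (ℤ.*-identityˡ (f x))) n ⟩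
    ((λ x → 1ℤ * f x) ⋆ (λ x → 0ℤ * g x)) n ≡⟨ ⋆-scale 1ℤ 0ℤ f g n ⟩
    0ℤ * (f ⋆ g) n                 ≡⟨ ℤ.*-zeroˡ ((f ⋆ g) n) ⟩
    0ℤ                             ∎
    where open ≡-Reasoning

  ⋆-∑ʳ : ∀ m (f : Seq) (G : ℕ → Seq) n → (f ⋆ (λ x → ∑ m (λ b → G b x))) n ≡ ∑ m (λ b → (f ⋆ G b) n)
  ⋆-∑ʳ zero    f G n = ⋆-zeroʳ f (λ _ → refl) n
  ⋆-∑ʳ (suc m) f G n = trans (⋆-+ʳ f (G 0) (λ x → ∑ m (λ b → G (suc b) x)) n) (cong (λ s → (f ⋆ G 0) n + s) (⋆-∑ʳ m f (G ∘ suc) n))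

  -- Below c + p n, each of the first c classes has n + 1 members and each of the other d has n.
  -- Writing p as c + d encodes this without comparisons.
  ∑-residues : ∀ c d n (h : Seq) → let p = c ℕ.+ d in
    ∑ (c ℕ.+ p ℕ.* n) h ≡
      ∑ c (λ b → ∑ (suc n) (residue p b h)) + ∑ d (λ j → ∑ n (residue p (c ℕ.+ j) h))
  ∑-residues c d zero h = begin
    ∑ (c ℕ.+ p ℕ.* 0) h
      ≡⟨ cong (λ m → ∑ m h) (trans (cong (c ℕ.+_) (ℕ.*-zeroʳ p)) (ℕ.+-identityʳ c)) ⟩
    ∑ c h
      ≡⟨ ∑-cong c (λ b _ → trans (cong h (sym (trans (cong (b ℕ.+_) (ℕ.*-zeroʳ p)) (ℕ.+-identityʳ b)))) (sym (ℤ.+-identityʳ _))) ⟩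
    ∑ c (λ b → ∑ 1 (residue p b h))
      ≡⟨ trans (cong (λ s → ∑ c (λ b → ∑ 1 (residue p b h)) + s) (∑-zero d (λ _ _ → refl))) (ℤ.+-identityʳ _) ⟨
    ∑ c (λ b → ∑ 1 (residue p b h)) + ∑ d (λ j → 0ℤ) ∎
    where
    open ≡-Reasoning
    p = c ℕ.+ d
  ∑-residues c d (suc n) h = begin
    ∑ (c ℕ.+ p ℕ.* suc n) h
      ≡⟨ cong (λ m → ∑ m h) (reorder c p n) ⟩
    ∑ (p ℕ.+ (c ℕ.+ p ℕ.* n)) h
      ≡⟨ ∑-++ p (c ℕ.+ p ℕ.* n) h ⟩
    ∑ p h + ∑ (c ℕ.+ p ℕ.* n) h′
      ≡⟨ cong₂ _+_ (∑-++ c d h) (∑-residues c d n h′) ⟩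
    ∑ c h + ∑ d (λ j → h (c ℕ.+ j)) + (∑ c (λ b → ∑ (suc n) (residue p b h′)) + ∑ d (λ j → ∑ n (residue p (c ℕ.+ j) h′)))
      ≡⟨ interchange (∑ c h) _ _ _ ⟩
    ∑ c h + ∑ c (λ b → ∑ (suc n) (residue p b h′)) + (∑ d (λ j → h (c ℕ.+ j)) + ∑ d (λ j → ∑ n (residue p (c ℕ.+ j) h′)))
      ≡⟨ cong₂ _+_ (∑-+ c h (λ b → ∑ (suc n) (residue p b h′))) (∑-+ d (λ j → h (c ℕ.+ j)) (λ j → ∑ n (residue p (c ℕ.+ j) h′))) ⟨
    ∑ c (λ b → h b + ∑ (suc n) (residue p b h′)) + ∑ d (λ j → h (c ℕ.+ j) + ∑ n (residue p (c ℕ.+ j) h′))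
      ≡⟨ cong₂ _+_ (∑-cong c (λ b _ → merge (suc n) b)) (∑-cong d (λ j _ → merge n (c ℕ.+ j))) ⟩
    ∑ c (λ b → ∑ (suc (suc n)) (residue p b h)) + ∑ d (λ j → ∑ (suc n) (residue p (c ℕ.+ j) h)) ∎
    where
    open ≡-Reasoning
    p = c ℕ.+ d
    h′ : Seq
    h′ k = h (p ℕ.+ k)
    reorder : ∀ c p n → c ℕ.+ p ℕ.* (1 ℕ.+ n) ≡ p ℕ.+ (c ℕ.+ p ℕ.* n)
    reorder = ℕSolver.solve-∀
    interchange : ∀ a b x y → a + b + (x + y) ≡ a + x + (b + y)
    interchange = solve-∀
    merge : ∀ m b → h b + ∑ m (residue p b h′) ≡ ∑ (suc m) (residue p b h)
    merge m b = cong₂ _+_ (cong h (sym (trans (cong (b ℕ.+_) (ℕ.*-zeroʳ p)) (ℕ.+-identityʳ b))))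
      (∑-cong m (λ x _ → cong h (sym (reorder b p x))))

  -- A class b ≤ c is completed by c - b without carry. A class c + 1 + j exceeds c and is completed
  -- by c + p - (c + 1 + j) = c + d - j with a carry.
  ⋆-residue : ∀ c d (f g : Seq) n → let p = suc c ℕ.+ d in
    residue p c (f ⋆ g) n ≡
      ∑ (suc c) (λ b → (residue p b f ⋆ residue p (c ∸ b) g) n)
      + ∑ d (λ j → shift (residue p (suc c ℕ.+ j) f ⋆ residue p (c ℕ.+ d ∸ j) g) n)
  ⋆-residue c d f g n = trans (⋆-def f g (c ℕ.+ p ℕ.* n)) (trans (∑-residues (suc c) d n h) (cong₂ _+_
    (∑-cong (suc c) (λ b b≤c → trans
      (∑-cong (suc n) (λ x x≤n → cong (λ k → residue p b f x * g k) (difference₁ (ℕ.≤-pred b≤c) (ℕ.≤-pred x≤n))))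
      (sym (⋆-def (residue p b f) (residue p (c ∸ b) g) n))))
    (∑-cong d (λ j j<d → second n j j<d))))
    where
    open ≡-Reasoning
    p = suc c ℕ.+ d
    h : Seq
    h i = f i * g (c ℕ.+ p ℕ.* n ∸ i)
    regroup₁ : ∀ b z p x y → b ℕ.+ z ℕ.+ p ℕ.* (x ℕ.+ y) ≡ b ℕ.+ p ℕ.* x ℕ.+ (z ℕ.+ p ℕ.* y)
    regroup₁ = ℕSolver.solve-∀
    difference₁ : ∀ {b x} → b ℕ.≤ c → x ℕ.≤ n → c ℕ.+ p ℕ.* n ∸ (b ℕ.+ p ℕ.* x) ≡ c ∸ b ℕ.+ p ℕ.* (n ∸ x)
    difference₁ {b} {x} b≤c x≤n = begin
      c ℕ.+ p ℕ.* n ∸ (b ℕ.+ p ℕ.* x)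
        ≡⟨ cong₂ (λ u v → u ℕ.+ p ℕ.* v ∸ (b ℕ.+ p ℕ.* x)) (ℕ.m+[n∸m]≡n b≤c) (ℕ.m+[n∸m]≡n x≤n) ⟨
      b ℕ.+ (c ∸ b) ℕ.+ p ℕ.* (x ℕ.+ (n ∸ x)) ∸ (b ℕ.+ p ℕ.* x)
        ≡⟨ cong (_∸ (b ℕ.+ p ℕ.* x)) (regroup₁ b (c ∸ b) p x (n ∸ x)) ⟩
      b ℕ.+ p ℕ.* x ℕ.+ (c ∸ b ℕ.+ p ℕ.* (n ∸ x)) ∸ (b ℕ.+ p ℕ.* x)
        ≡⟨ ℕ.m+n∸m≡n (b ℕ.+ p ℕ.* x) _ ⟩
      c ∸ b ℕ.+ p ℕ.* (n ∸ x) ∎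
    regroup₂ : ∀ c p x y → c ℕ.+ (p ℕ.+ p ℕ.* (x ℕ.+ y)) ≡ c ℕ.+ p ℕ.+ p ℕ.* x ℕ.+ p ℕ.* y
    regroup₂ = ℕSolver.solve-∀
    regroup₃ : ∀ c j z p x y → c ℕ.+ (1 ℕ.+ (j ℕ.+ z)) ℕ.+ p ℕ.* x ℕ.+ p ℕ.* y ≡ 1 ℕ.+ c ℕ.+ j ℕ.+ p ℕ.* x ℕ.+ (z ℕ.+ p ℕ.* y)
    regroup₃ = ℕSolver.solve-∀
    difference₂ : ∀ {j m x} → j ℕ.< d → x ℕ.≤ m →
      c ℕ.+ p ℕ.* suc m ∸ (suc c ℕ.+ j ℕ.+ p ℕ.* x) ≡ c ℕ.+ d ∸ j ℕ.+ p ℕ.* (m ∸ x)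
    difference₂ {j} {m} {x} j<d x≤m = begin
      c ℕ.+ p ℕ.* suc m ∸ i
        ≡⟨ cong (λ v → c ℕ.+ v ∸ i) (ℕ.*-suc p m) ⟩
      c ℕ.+ (p ℕ.+ p ℕ.* m) ∸ i
        ≡⟨ cong (λ v → c ℕ.+ (p ℕ.+ p ℕ.* v) ∸ i) (ℕ.m+[n∸m]≡n x≤m) ⟨
      c ℕ.+ (p ℕ.+ p ℕ.* (x ℕ.+ (m ∸ x))) ∸ i
        ≡⟨ cong (_∸ i) (regroup₂ c p x (m ∸ x)) ⟩
      c ℕ.+ p ℕ.+ p ℕ.* x ℕ.+ p ℕ.* (m ∸ x) ∸ i
        ≡⟨ cong (λ v → c ℕ.+ suc v ℕ.+ p ℕ.* x ℕ.+ p ℕ.* (m ∸ x) ∸ i) (ℕ.m+[n∸m]≡n (ℕ.≤-trans (ℕ.<⇒≤ j<d) (ℕ.m≤n+m d c))) ⟨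
      c ℕ.+ suc (j ℕ.+ z) ℕ.+ p ℕ.* x ℕ.+ p ℕ.* (m ∸ x) ∸ i
        ≡⟨ cong (_∸ i) (regroup₃ c j z p x (m ∸ x)) ⟩
      i ℕ.+ (z ℕ.+ p ℕ.* (m ∸ x)) ∸ i
        ≡⟨ ℕ.m+n∸m≡n i _ ⟩
      z ℕ.+ p ℕ.* (m ∸ x) ∎
      where
      z = c ℕ.+ d ∸ j
      i = suc c ℕ.+ j ℕ.+ p ℕ.* x
    second : ∀ n j → j ℕ.< d → ∑ n (λ x → f (suc c ℕ.+ j ℕ.+ p ℕ.* x) * g (c ℕ.+ p ℕ.* n ∸ (suc c ℕ.+ j ℕ.+ p ℕ.* x)))
      ≡ shift (residue p (suc c ℕ.+ j) f ⋆ residue p (c ℕ.+ d ∸ j) g) n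
    second zero    j j<d = refl
    second (suc m) j j<d = trans
      (∑-cong (suc m) (λ x x≤m → cong (λ k → residue p (suc c ℕ.+ j) f x * g k) (difference₂ j<d (ℕ.≤-pred x≤m))))
      (sym (⋆-def (residue p (suc c ℕ.+ j) f) (residue p (c ℕ.+ d ∸ j) g) m))

  -- The residues of k₁ , k₂ , k₃ add up to p or to 2p; those of the second kind are indexed by
  -- their complements to p.
  ⋆⋆-residues : ∀ p-1 (f g h : Seq) → let p = suc p-1 in
    (∀ x → residue p 0 f x ≡ 0ℤ) → (∀ x → residue p 0 g x ≡ 0ℤ) → (∀ x → residue p 0 h x ≡ 0ℤ) → ∀ n →
    (f ⋆ (g ⋆ h)) (p ℕ.* suc n) ≡ ∑ p-1 (λ a → ∑ (p-1 ∸ suc a) (λ b →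
      (residue p (suc a) f ⋆ (residue p (suc b) g ⋆ residue p (p-1 ∸ suc a ∸ b) h)) n
      + shift (residue p (p-1 ∸ a) f ⋆ (residue p (p-1 ∸ b) g ⋆ residue p (2 ℕ.+ a ℕ.+ b) h)) n))
  ⋆⋆-residues p-1 f g h f₀≡0 g₀≡0 h₀≡0 n = begin
    residue p 0 (f ⋆ (g ⋆ h)) (suc n)
      ≡⟨ ⋆-residue 0 p-1 f (g ⋆ h) (suc n) ⟩
    (r 0 f ⋆ r 0 (g ⋆ h)) (suc n) + 0ℤ + ∑ p-1 (λ a → (r (suc a) f ⋆ r (p-1 ∸ a) (g ⋆ h)) n)
      ≡⟨ cong (λ s → s + 0ℤ + ∑ p-1 (λ a → (r (suc a) f ⋆ r (p-1 ∸ a) (g ⋆ h)) n)) (⋆-zeroˡ (r 0 (g ⋆ h)) f₀≡0 (suc n)) ⟩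
    0ℤ + ∑ p-1 (λ a → (r (suc a) f ⋆ r (p-1 ∸ a) (g ⋆ h)) n)
      ≡⟨ ℤ.+-identityˡ _ ⟩
    ∑ p-1 (λ a → (r (suc a) f ⋆ r (p-1 ∸ a) (g ⋆ h)) n)
      ≡⟨ ∑-cong p-1 (λ a a<p-1 → split-inner a a<p-1) ⟩
    ∑ p-1 (λ a → low a + high a)
      ≡⟨ ∑-+ p-1 low high ⟩
    ∑ p-1 low + ∑ p-1 high
      -- Reversing the sum replaces the first residue 1 + a by its complement p - (1 + a); `reflect`
      -- does the same for the second, so that both kinds of terms share one index set.
      ≡⟨ cong (λ s → ∑ p-1 low + s) (trans (∑-reverse p-1 high) (∑-cong p-1 reflect)) ⟩
    ∑ p-1 low + ∑ p-1 high′
      ≡⟨ ∑-+ p-1 low high′ ⟨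
    ∑ p-1 (λ a → low a + high′ a)
      ≡⟨ ∑-cong p-1 (λ a _ → sym (∑-+ (p-1 ∸ suc a) (low-term a) (high′-term a))) ⟩
    ∑ p-1 (λ a → ∑ (p-1 ∸ suc a) (λ b → low-term a b + high′-term a b)) ∎
    where
    open ≡-Reasoning
    p = suc p-1
    r = residue p
    low-term high-term high′-term : ℕ → ℕ → ℤ
    low-term a b = (r (suc a) f ⋆ (r (suc b) g ⋆ r (p-1 ∸ suc a ∸ b) h)) n
    high-term a i = shift (r (suc a) f ⋆ (r (suc (p-1 ∸ a) ℕ.+ i) g ⋆ r (p-1 ∸ i) h)) n
    high′-term a b = shift (r (p-1 ∸ a) f ⋆ (r (p-1 ∸ b) g ⋆ r (2 ℕ.+ a ℕ.+ b) h)) n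
    low high high′ : ℕ → ℤ
    low a = ∑ (p-1 ∸ suc a) (low-term a)
    high a = ∑ a (high-term a)
    high′ a = ∑ (p-1 ∸ suc a) (high′-term a)

    -- The two boundary terms, where g or h is taken on the multiples of p, vanish by hypothesis.
    inner : ∀ c d → suc c ℕ.+ d ≡ p-1 → ∀ x → r (suc c) (g ⋆ h) x ≡
      ∑ c (λ b → (r (suc b) g ⋆ r (c ∸ b) h) x) + ∑ d (λ i → shift (r (suc (suc c) ℕ.+ i) g ⋆ r (p-1 ∸ i) h) x)
    inner c d refl x = trans (⋆-residue (suc c) d g h x) (cong (_+ ∑ d (λ i → shift (r (suc (suc c) ℕ.+ i) g ⋆ r (p-1 ∸ i) h) x)) (begin
      (r 0 g ⋆ r (suc c) h) x + ∑ (suc c) (λ b → (r (suc b) g ⋆ r (c ∸ b) h) x)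
        ≡⟨ cong₂ _+_ (⋆-zeroˡ (r (suc c) h) g₀≡0 x) (∑-last c (λ b → (r (suc b) g ⋆ r (c ∸ b) h) x)) ⟩
      0ℤ + (∑ c (λ b → (r (suc b) g ⋆ r (c ∸ b) h) x) + (r (suc c) g ⋆ r (c ∸ c) h) x)
        ≡⟨ cong (λ k → 0ℤ + (∑ c (λ b → (r (suc b) g ⋆ r (c ∸ b) h) x) + (r (suc c) g ⋆ r k h) x)) (ℕ.n∸n≡0 c) ⟩
      0ℤ + (∑ c (λ b → (r (suc b) g ⋆ r (c ∸ b) h) x) + (r (suc c) g ⋆ r 0 h) x)
        ≡⟨ cong (λ s → 0ℤ + (∑ c (λ b → (r (suc b) g ⋆ r (c ∸ b) h) x) + s)) (⋆-zeroʳ (r (suc c) g) h₀≡0 x) ⟩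
      0ℤ + (∑ c (λ b → (r (suc b) g ⋆ r (c ∸ b) h) x) + 0ℤ)
        ≡⟨ trans (ℤ.+-identityˡ _) (ℤ.+-identityʳ _) ⟩
      ∑ c (λ b → (r (suc b) g ⋆ r (c ∸ b) h) x) ∎))

    split-inner : ∀ a → a ℕ.< p-1 → (r (suc a) f ⋆ r (p-1 ∸ a) (g ⋆ h)) n ≡ low a + high a
    split-inner a a<p-1 = begin
      (F ⋆ r (p-1 ∸ a) (g ⋆ h)) n
        ≡⟨ cong (λ k → (F ⋆ r k (g ⋆ h)) n) p-1∸a≡1+c ⟩
      (F ⋆ r (suc c) (g ⋆ h)) n
        ≡⟨ ⋆-congʳ F (inner c a 1+c+a≡p-1) n ⟩
      (F ⋆ (λ x → ∑ c (λ b → G₁ b x) + ∑ a (λ i → shift (G₂ (suc c) i) x))) n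
        ≡⟨ ⋆-+ʳ F (λ x → ∑ c (λ b → G₁ b x)) (λ x → ∑ a (λ i → shift (G₂ (suc c) i) x)) n ⟩
      (F ⋆ (λ x → ∑ c (λ b → G₁ b x))) n + (F ⋆ (λ x → ∑ a (λ i → shift (G₂ (suc c) i) x))) n
        ≡⟨ cong₂ _+_ (⋆-∑ʳ c F G₁ n) (trans (⋆-∑ʳ a F (λ i → shift (G₂ (suc c) i)) n) (∑-cong a (λ i _ → ⋆-shift F (G₂ (suc c) i) n))) ⟩
      ∑ c (λ b → (F ⋆ G₁ b) n) + ∑ a (λ i → shift (F ⋆ G₂ (suc c) i) n)
        ≡⟨ cong (λ k → ∑ c (λ b → (F ⋆ G₁ b) n) + ∑ a (λ i → shift (F ⋆ G₂ k i) n)) p-1∸a≡1+c ⟨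
      low a + high a ∎
      where
      c = p-1 ∸ suc a
      F = r (suc a) f
      G₁ : ℕ → Seq
      G₁ b = r (suc b) g ⋆ r (c ∸ b) h
      G₂ : ℕ → ℕ → Seq
      G₂ k i = r (suc k ℕ.+ i) g ⋆ r (p-1 ∸ i) h
      p-1∸a≡1+c : p-1 ∸ a ≡ suc c
      p-1∸a≡1+c = ℕ.+-∸-assoc 1 a<p-1
      1+c+a≡p-1 : suc c ℕ.+ a ≡ p-1
      1+c+a≡p-1 = trans (cong (ℕ._+ a) (sym p-1∸a≡1+c)) (ℕ.m∸n+n≡m (ℕ.<⇒≤ a<p-1))

    reflect : ∀ a → a ℕ.< p-1 → high (p-1 ∸ suc a) ≡ high′ a
    reflect a a<p-1 = trans (∑-reverse L (high-term L)) (∑-cong L (λ b b<L → terms b b<L))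
      where
      L = p-1 ∸ suc a
      p-1≡1+a+L : p-1 ≡ suc a ℕ.+ L
      p-1≡1+a+L = sym (ℕ.m+[n∸m]≡n a<p-1)
      terms : ∀ b → b ℕ.< L → high-term L (L ∸ suc b) ≡ high′-term a b
      terms b b<L = cong (λ F → shift F n) (cong₃ index₁ index₂ index₃)
        where
        M = L ∸ suc b
        L≡1+b+M : L ≡ suc b ℕ.+ M
        L≡1+b+M = sym (ℕ.m+[n∸m]≡n b<L)
        cong₃ : ∀ {i i′ j j′ k k′} → i ≡ i′ → j ≡ j′ → k ≡ k′ → r i f ⋆ (r j g ⋆ r k h) ≡ r i′ f ⋆ (r j′ g ⋆ r k′ h)
        cong₃ refl refl refl = refl
        index₁ : suc L ≡ p-1 ∸ a
        index₁ = sym (ℕ.+-∸-assoc 1 a<p-1)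
        p-1≡a+b+M+2 : p-1 ≡ suc a ℕ.+ (suc b ℕ.+ M)
        p-1≡a+b+M+2 = trans p-1≡1+a+L (cong (suc a ℕ.+_) L≡1+b+M)
        regroup : ∀ a b m → 1 ℕ.+ a ℕ.+ (1 ℕ.+ b ℕ.+ m) ≡ b ℕ.+ (1 ℕ.+ (1 ℕ.+ a) ℕ.+ m)
        regroup = ℕSolver.solve-∀
        regroup′ : ∀ a b m → 1 ℕ.+ a ℕ.+ (1 ℕ.+ b ℕ.+ m) ≡ m ℕ.+ (2 ℕ.+ a ℕ.+ b)
        regroup′ = ℕSolver.solve-∀
        index₂ : suc (p-1 ∸ L) ℕ.+ M ≡ p-1 ∸ b
        index₂ = begin
          suc (p-1 ∸ L) ℕ.+ M             ≡⟨ cong (λ k → suc (k ∸ L) ℕ.+ M) p-1≡1+a+L ⟩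
          suc (suc a ℕ.+ L ∸ L) ℕ.+ M     ≡⟨ cong (λ k → suc k ℕ.+ M) (ℕ.m+n∸n≡m (suc a) L) ⟩
          suc (suc a) ℕ.+ M               ≡⟨ ℕ.m+n∸m≡n b _ ⟨
          b ℕ.+ (suc (suc a) ℕ.+ M) ∸ b   ≡⟨ cong (_∸ b) (trans p-1≡a+b+M+2 (regroup a b M)) ⟨
          p-1 ∸ b                         ∎
        index₃ : p-1 ∸ M ≡ 2 ℕ.+ a ℕ.+ b
        index₃ = begin
          p-1 ∸ M                     ≡⟨ cong (_∸ M) (trans p-1≡a+b+M+2 (regroup′ a b M)) ⟩
          M ℕ.+ (2 ℕ.+ a ℕ.+ b) ∸ M   ≡⟨ ℕ.m+n∸m≡n M _ ⟩
          2 ℕ.+ a ℕ.+ b               ∎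

  -- Powers of units and their threefold convolution

  -- Extension by 0 to the multiples of p builds the coprimality conditions into the summand, so
  -- that the restricted sum becomes a plain convolution.
  unitPower : ℕ → ℕ → Seq
  unitPower p s k = if does (p ℕ.∣? k) then 0ℤ else (+ k) ^ s

  unitPower-∣ : ∀ {p} s {k} → p ℕ.∣ k → unitPower p s k ≡ 0ℤ
  unitPower-∣ {p} s {k} p∣k with p ℕ.∣? k
  ... | yes _  = refl
  ... | no p∤k = contradiction p∣k p∤k

  unitPower-∤ : ∀ {p} s {k} → ¬ p ℕ.∣ k → unitPower p s k ≡ (+ k) ^ s
  unitPower-∤ {p} s {k} p∤k with p ℕ.∣? k
  ... | yes p∣k = contradiction p∣k p∤k
  ... | no _    = refl

  unitPower-residue : ∀ {p} s {a} → 0 ℕ.< a → a ℕ.< p → ∀ x → residue p a (unitPower p s) x ≡ (+ a + + p * + x) ^ s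
  unitPower-residue {p} s {a} 0<a a<p x = trans
    (unitPower-∤ s (λ p∣a+px → p∤0<m<p 0<a a<p
      (ℕ.∣m+n∣m⇒∣n (subst (p ℕ.∣_) (ℕ.+-comm a (p ℕ.* x)) p∣a+px) (ℕ.m∣m*n x))))
    (cong (_^ s) (trans (ℤ.pos-+ a (p ℕ.* x)) (cong (λ z → + a + z) (ℤ.pos-* p x))))

  -- Because p = a + a′, the number a′ + p y is the negative of a + p x at x = -1 - y. This links a
  -- complementary class to the second component of a Newton pair.
  unitPower-residue⁻ : ∀ {p} s {a a′} → 0 ℕ.< a → 0 ℕ.< a′ → a ℕ.+ a′ ≡ p → ∀ y →
    residue p a′ (unitPower p s) y ≡ -1ℤ ^ s * (+ a - + p - + p * + y) ^ s
  unitPower-residue⁻ {p} s {a} {a′} 0<a 0<a′ refl y = begin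
    residue p a′ (unitPower p s) y       ≡⟨ unitPower-residue s 0<a′ (ℕ.m<n+m a′ 0<a) y ⟩
    (+ a′ + + p * + y) ^ s               ≡⟨ cong (_^ s) (trans (negate (+ a) (+ a′) (+ p * + y)) (cong (λ P → - (+ a - P - + p * + y)) (sym (ℤ.pos-+ a a′)))) ⟩
    (- (+ a - + p - + p * + y)) ^ s      ≡⟨ ^-neg (+ a - + p - + p * + y) s ⟩
    -1ℤ ^ s * (+ a - + p - + p * + y) ^ s ∎
    where
    open ≡-Reasoning
    negate : ∀ a a′ z → a′ + z ≡ - (a - (a + a′) - z)
    negate = solve-∀

  ∑-∣-diff : ∀ n {d} c (f g : Seq) → (∀ i → i ℕ.< n → d ∣ f i - c * g i) → d ∣ ∑ n f - c * ∑ n g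
  ∑-∣-diff zero c f g _ = divides 0ℤ (cong (λ z → 0ℤ - z) (ℤ.*-zeroʳ c))
  ∑-∣-diff (suc n) {d} c f g d∣ = subst (d ∣_) (regroup c (f 0) (∑ n (f ∘ suc)) (g 0) (∑ n (g ∘ suc)))
    (∣m∣n⇒∣m+n (d∣ 0 (s≤s z≤n)) (∑-∣-diff n c (f ∘ suc) (g ∘ suc) (λ i i<n → d∣ (suc i) (s≤s i<n))))
    where
    regroup : ∀ c a x b y → a - c * b + (x - c * y) ≡ a + x - c * (b + y)
    regroup = solve-∀

  module _ {p-1 : ℕ} (p-prime : Prime (suc p-1)) (5≤p : 5 ℕ.≤ suc p-1) {e : ℕ} (e≡1⊎2 : e ≡ 1 ⊎ e ≡ 2)
    (A₁ A₂ A₃ : ℕ) (sign : -1ℤ ^ A₁ * (-1ℤ ^ A₂ * -1ℤ ^ A₃) ≡ -1ℤ ^ e) where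

    private
      p = suc p-1
      P = + p
      r = residue p
      f = unitPower p A₁
      g = unitPower p A₂
      h = unitPower p A₃
      F⁺ F⁻ : ℕ → ℕ → Seq
      F⁺ s a x = (+ a + P * + x) ^ s
      F⁻ s a y = (+ a - P - P * + y) ^ s

    -- T collects a triple of classes with its complement. For n = 1 the shift removes the
    -- complement, whose members add up to at least 2p, and leaves the single product of the
    -- residues.
    classes-congruence : ∀ R t → + 2 + + t ≡ P ^ R → ∀ {a a′ b b′ c c′} →
      0 ℕ.< a → 0 ℕ.< a′ → a ℕ.+ a′ ≡ p → 0 ℕ.< b → 0 ℕ.< b′ → b ℕ.+ b′ ≡ p → 0 ℕ.< c → 0 ℕ.< c′ → c ℕ.+ c′ ≡ p →
      let T = λ n → (r a f ⋆ (r b g ⋆ r c h)) n + shift (r a′ f ⋆ (r b′ g ⋆ r c′ h)) n in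
      (P * (+ 2 + + t)) ^ e ∣ T (suc t) - (+ 2 + + t) ^ e * T 0
    classes-congruence R t n≡pᴿ {a} {a′} {b} {b′} {c} {c′} 0<a 0<a′ a+a′ 0<b 0<b′ b+b′ 0<c 0<c′ c+c′ =
      subst ((P * (+ 2 + + t)) ^ e ∣_) (sym (cong₂ (λ x y → x - (+ 2 + + t) ^ e * y) (cong₂ _+_ value⁺ value⁻) value₀))
        (∣defect p-prime 5≤p e≡1⊎2 R t n≡pᴿ (Newton-^ (+ a) A₁) (Newton-^ (+ b) A₂) (Newton-^ (+ c) A₃))
      where
      open ≡-Reasoning
      f⁺ : ∀ x → r a f x ≡ F⁺ A₁ a x
      f⁺ = unitPower-residue A₁ 0<a (subst (a ℕ.<_) a+a′ (ℕ.m<m+n a 0<a′))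
      g⁺ : ∀ x → r b g x ≡ F⁺ A₂ b x
      g⁺ = unitPower-residue A₂ 0<b (subst (b ℕ.<_) b+b′ (ℕ.m<m+n b 0<b′))
      h⁺ : ∀ x → r c h x ≡ F⁺ A₃ c x
      h⁺ = unitPower-residue A₃ 0<c (subst (c ℕ.<_) c+c′ (ℕ.m<m+n c 0<c′))
      value⁺ : (r a f ⋆ (r b g ⋆ r c h)) (suc t) ≡ (F⁺ A₁ a ⋆ (F⁺ A₂ b ⋆ F⁺ A₃ c)) (suc t)
      value⁺ = ⋆-cong f⁺ (⋆-cong g⁺ h⁺) (suc t)
      value⁻ : (r a′ f ⋆ (r b′ g ⋆ r c′ h)) t ≡ -1ℤ ^ e * (F⁻ A₁ a ⋆ (F⁻ A₂ b ⋆ F⁻ A₃ c)) t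
      value⁻ = begin
        (r a′ f ⋆ (r b′ g ⋆ r c′ h)) t
          ≡⟨ ⋆-cong (unitPower-residue⁻ A₁ 0<a 0<a′ a+a′)
               (⋆-cong (unitPower-residue⁻ A₂ 0<b 0<b′ b+b′) (unitPower-residue⁻ A₃ 0<c 0<c′ c+c′)) t ⟩
        ((λ y → -1ℤ ^ A₁ * F⁻ A₁ a y) ⋆ ((λ y → -1ℤ ^ A₂ * F⁻ A₂ b y) ⋆ (λ y → -1ℤ ^ A₃ * F⁻ A₃ c y))) t
          ≡⟨ ⋆⋆-scale (-1ℤ ^ A₁) (-1ℤ ^ A₂) (-1ℤ ^ A₃) (F⁻ A₁ a) (F⁻ A₂ b) (F⁻ A₃ c) t ⟩
        -1ℤ ^ A₁ * (-1ℤ ^ A₂ * -1ℤ ^ A₃) * (F⁻ A₁ a ⋆ (F⁻ A₂ b ⋆ F⁻ A₃ c)) t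
          ≡⟨ cong (_* (F⁻ A₁ a ⋆ (F⁻ A₂ b ⋆ F⁻ A₃ c)) t) sign ⟩
        -1ℤ ^ e * (F⁻ A₁ a ⋆ (F⁻ A₂ b ⋆ F⁻ A₃ c)) t ∎
      value₀ : (r a f ⋆ (r b g ⋆ r c h)) 0 + 0ℤ ≡ F⁺ A₁ a 0 * (F⁺ A₂ b 0 * F⁺ A₃ c 0)
      value₀ = begin
        (r a f ⋆ (r b g ⋆ r c h)) 0 + 0ℤ           ≡⟨ ℤ.+-identityʳ _ ⟩
        (r a f ⋆ (r b g ⋆ r c h)) 0                ≡⟨ ⋆-cong f⁺ (⋆-cong g⁺ h⁺) 0 ⟩
        (F⁺ A₁ a ⋆ (F⁺ A₂ b ⋆ F⁺ A₃ c)) 0             ≡⟨ ⋆-0 (F⁺ A₁ a) (F⁺ A₂ b ⋆ F⁺ A₃ c) ⟩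
        F⁺ A₁ a 0 * (F⁺ A₂ b ⋆ F⁺ A₃ c) 0             ≡⟨ cong (F⁺ A₁ a 0 *_) (⋆-0 (F⁺ A₂ b) (F⁺ A₃ c)) ⟩
        F⁺ A₁ a 0 * (F⁺ A₂ b 0 * F⁺ A₃ c 0)           ∎

    unitPower-⋆-⋆-congruence : ∀ R t → + 2 + + t ≡ P ^ R →
      (P * (+ 2 + + t)) ^ e ∣ (f ⋆ (g ⋆ h)) (p ℕ.* (2 ℕ.+ t)) - (+ 2 + + t) ^ e * (f ⋆ (g ⋆ h)) (p ℕ.* 1)
    unitPower-⋆-⋆-congruence R t n≡pᴿ = subst (Q ∣_)
      (sym (cong₂ (λ x y → x - (+ 2 + + t) ^ e * y)
        (⋆⋆-residues p-1 f g h (multiple A₁) (multiple A₂) (multiple A₃) (suc t))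
        (⋆⋆-residues p-1 f g h (multiple A₁) (multiple A₂) (multiple A₃) 0)))
      (∑-∣-diff p-1 N (λ a → ∑ (p-1 ∸ suc a) (T (suc t) a)) (λ a → ∑ (p-1 ∸ suc a) (T 0 a))
        (λ a a<p-1 → ∑-∣-diff (p-1 ∸ suc a) N (T (suc t) a) (T 0 a) (terms a a<p-1)))
      where
      Q = (P * (+ 2 + + t)) ^ e
      multiple : ∀ s x → residue p 0 (unitPower p s) x ≡ 0ℤ
      multiple s x = unitPower-∣ s (ℕ.m∣m*n x)
      N = (+ 2 + + t) ^ e
      T : ℕ → ℕ → ℕ → ℤ
      T n a b = (r (suc a) f ⋆ (r (suc b) g ⋆ r (p-1 ∸ suc a ∸ b) h)) n
        + shift (r (p-1 ∸ a) f ⋆ (r (p-1 ∸ b) g ⋆ r (2 ℕ.+ a ℕ.+ b) h)) n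
      terms : ∀ a → a ℕ.< p-1 → ∀ b → b ℕ.< p-1 ∸ suc a → Q ∣ T (suc t) a b - N * T 0 a b
      -- The residues are 1 + a, 1 + b and p - (1 + a) - (1 + b); the last is positive because of
      -- the range of b.
      terms a a<p-1 b b<L = classes-congruence R t n≡pᴿ
        (s≤s z≤n) (ℕ.m<n⇒0<n∸m a<p-1) (cong suc (ℕ.m+[n∸m]≡n (ℕ.<⇒≤ a<p-1)))
        (s≤s z≤n) (ℕ.m<n⇒0<n∸m b<p-1) (cong suc (ℕ.m+[n∸m]≡n (ℕ.<⇒≤ b<p-1)))
        (ℕ.m<n⇒0<n∸m b<L) (s≤s z≤n) third
        where
        open ≡-Reasoning
        b<p-1 : b ℕ.< p-1
        b<p-1 = ℕ.<-≤-trans b<L (ℕ.m∸n≤m p-1 (suc a))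
        regroup : ∀ c a b → c ℕ.+ (2 ℕ.+ a ℕ.+ b) ≡ 1 ℕ.+ (1 ℕ.+ a ℕ.+ (b ℕ.+ c))
        regroup = ℕSolver.solve-∀
        third : p-1 ∸ suc a ∸ b ℕ.+ (2 ℕ.+ a ℕ.+ b) ≡ suc p-1
        third = begin
          p-1 ∸ suc a ∸ b ℕ.+ (2 ℕ.+ a ℕ.+ b)            ≡⟨ regroup (p-1 ∸ suc a ∸ b) a b ⟩
          suc (suc a ℕ.+ (b ℕ.+ (p-1 ∸ suc a ∸ b)))      ≡⟨ cong (λ x → suc (suc a ℕ.+ x)) (ℕ.m+[n∸m]≡n (ℕ.<⇒≤ b<L)) ⟩
          suc (suc a ℕ.+ (p-1 ∸ suc a))                  ≡⟨ cong suc (ℕ.m+[n∸m]≡n a<p-1) ⟩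
          suc p-1                                        ∎

  -- Congruences between rationals

  ι : ℤ → ℚ
  ι i = i / 1

  toℚᵘ-ι : ∀ i → ℚ.toℚᵘ (ι i) ℚᵘ.≃ mkℚᵘ i 0
  toℚᵘ-ι i = ℚ.toℚᵘ-fromℚᵘ (mkℚᵘ i 0)

  ι-+ : ∀ i j → ι (i + j) ≡ ι i ℚ.+ ι j
  ι-+ i j = ℚ.toℚᵘ-injective (begin
    ℚ.toℚᵘ (ι (i + j))                     ≈⟨ toℚᵘ-ι (i + j) ⟩
    mkℚᵘ (i + j) 0                         ≈⟨ *≡* (numerators i j) ⟩
    mkℚᵘ i 0 ℚᵘ.+ mkℚᵘ j 0                 ≈⟨ ℚᵘ.+-cong (toℚᵘ-ι i) (toℚᵘ-ι j) ⟨
    ℚ.toℚᵘ (ι i) ℚᵘ.+ ℚ.toℚᵘ (ι j)         ≈⟨ ℚ.toℚᵘ-homo-+ (ι i) (ι j) ⟨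
    ℚ.toℚᵘ (ι i ℚ.+ ι j)                   ∎)
    where
    open ℚᵘ.≃-Reasoning
    numerators : ∀ i j → (i + j) * 1ℤ ≡ (i * 1ℤ + j * 1ℤ) * 1ℤ
    numerators = solve-∀

  ι-* : ∀ i j → ι (i * j) ≡ ι i ℚ.* ι j
  ι-* i j = ℚ.toℚᵘ-injective (begin
    ℚ.toℚᵘ (ι (i * j))                     ≈⟨ toℚᵘ-ι (i * j) ⟩
    mkℚᵘ i 0 ℚᵘ.* mkℚᵘ j 0                 ≈⟨ ℚᵘ.*-cong (toℚᵘ-ι i) (toℚᵘ-ι j) ⟨
    ℚ.toℚᵘ (ι i) ℚᵘ.* ℚ.toℚᵘ (ι j)         ≈⟨ ℚ.toℚᵘ-homo-* (ι i) (ι j) ⟨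
    ℚ.toℚᵘ (ι i ℚ.* ι j)                   ∎)
    where open ℚᵘ.≃-Reasoning

  ι-neg : ∀ i → ι (- i) ≡ ℚ.- ι i
  ι-neg i = ℚ.toℚᵘ-injective (begin
    ℚ.toℚᵘ (ι (- i))                       ≈⟨ toℚᵘ-ι (- i) ⟩
    ℚᵘ.- mkℚᵘ i 0                          ≈⟨ ℚᵘ.-‿cong (toℚᵘ-ι i) ⟨
    ℚᵘ.- ℚ.toℚᵘ (ι i)                      ≈⟨ ℚ.toℚᵘ-homo‿- (ι i) ⟨
    ℚ.toℚᵘ (ℚ.- ι i)                       ∎)
    where open ℚᵘ.≃-Reasoning

  ι-*-inv : ∀ k → ι (+ suc k) ℚ.* inv (suc k) ≡ 1ℚ
  ι-*-inv k = ℚ.toℚᵘ-injective (begin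
    ℚ.toℚᵘ (ι (+ suc k) ℚ.* inv (suc k))             ≈⟨ ℚ.toℚᵘ-homo-* (ι (+ suc k)) (inv (suc k)) ⟩
    ℚ.toℚᵘ (ι (+ suc k)) ℚᵘ.* ℚ.toℚᵘ (inv (suc k))   ≈⟨ ℚᵘ.*-cong (toℚᵘ-ι (+ suc k)) (ℚ.toℚᵘ-fromℚᵘ (mkℚᵘ 1ℤ k)) ⟩
    mkℚᵘ (+ suc k) 0 ℚᵘ.* mkℚᵘ 1ℤ k                  ≈⟨ *≡* (cross (+ suc k)) ⟩
    ℚ.toℚᵘ 1ℚ                                        ∎)
    where
    open ℚᵘ.≃-Reasoning
    cross : ∀ x → x * 1ℤ * 1ℤ ≡ 1ℤ * (1ℤ * x)
    cross = solve-∀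

  module _ {p : ℕ} (p-prime : Prime p) (m : ℕ) where

    private
      Q = ι (+ (p ℕ.^ m))

    ModEq-ι : ∀ i j → + (p ℕ.^ m) ∣ i - j → ModEq p m (ι i) (ι j)
    ModEq-ι i j (divides q eq) = q , 1ℤ , p∤1 p-prime , (begin
      1ℚ ℚ.* (ι i ℚ.- ι j)           ≡⟨ ℚ.*-identityˡ _ ⟩
      ι i ℚ.- ι j                    ≡⟨ cong (ι i ℚ.+_) (ι-neg j) ⟨
      ι i ℚ.+ ι (- j)                ≡⟨ ι-+ i (- j) ⟨
      ι (i - j)                      ≡⟨ cong ι (trans eq (ℤ.*-comm q _)) ⟩
      ι (+ (p ℕ.^ m) * q)            ≡⟨ ι-* (+ (p ℕ.^ m)) q ⟩
      Q ℚ.* ι q                      ∎)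
      where open ≡-Reasoning

    ModEq-refl : ∀ x → ModEq p m x x
    ModEq-refl x = 0ℤ , 1ℤ , p∤1 p-prime , (begin
      1ℚ ℚ.* (x ℚ.- x) ≡⟨ cong (1ℚ ℚ.*_) (ℚ.+-inverseʳ x) ⟩
      0ℚ               ≡⟨ ℚ.*-zeroʳ Q ⟨
      Q ℚ.* 0ℚ         ∎)
      where open ≡-Reasoning

    ∤-∣*∣ : ∀ b b′ → ¬ p ℕ.∣ ℤ.∣ b ∣ → ¬ p ℕ.∣ ℤ.∣ b′ ∣ → ¬ p ℕ.∣ ℤ.∣ b * b′ ∣
    ∤-∣*∣ b b′ p∤b p∤b′ = subst (λ k → ¬ p ℕ.∣ k) (sym (ℤ.abs-* b b′)) (∤-* p-prime p∤b p∤b′)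

    -- Sums and transitivity both write one difference as a sum of two others; multiplying the two
    -- denominators is done here once for both.
    ModEq-lin : ∀ w x y z u v → ModEq p m w x → ModEq p m y z → u ℚ.- v ≡ (w ℚ.- x) ℚ.+ (y ℚ.- z) → ModEq p m u v
    ModEq-lin w x y z u v (a , b , p∤b , eq) (a′ , b′ , p∤b′ , eq′) u-v =
      b′ * a + b * a′ , b * b′ , ∤-∣*∣ b b′ p∤b p∤b′ , (begin
      ι (b * b′) ℚ.* (u ℚ.- v)
        ≡⟨ cong₂ ℚ._*_ (ι-* b b′) u-v ⟩
      ι b ℚ.* ι b′ ℚ.* ((w ℚ.- x) ℚ.+ (y ℚ.- z))
        ≡⟨ solve 4 (λ b b′ s t → b :* b′ :* (s :+ t) := b′ :* (b :* s) :+ b :* (b′ :* t)) refl (ι b) (ι b′) (w ℚ.- x) (y ℚ.- z) ⟩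
      ι b′ ℚ.* (ι b ℚ.* (w ℚ.- x)) ℚ.+ ι b ℚ.* (ι b′ ℚ.* (y ℚ.- z))
        ≡⟨ cong₂ (λ s t → ι b′ ℚ.* s ℚ.+ ι b ℚ.* t) eq eq′ ⟩
      ι b′ ℚ.* (Q ℚ.* ι a) ℚ.+ ι b ℚ.* (Q ℚ.* ι a′)
        ≡⟨ solve 5 (λ q b b′ a a′ → b′ :* (q :* a) :+ b :* (q :* a′) := q :* (b′ :* a :+ b :* a′)) refl Q (ι b) (ι b′) (ι a) (ι a′) ⟩
      Q ℚ.* (ι b′ ℚ.* ι a ℚ.+ ι b ℚ.* ι a′)
        ≡⟨ cong (Q ℚ.*_) (trans (ι-+ (b′ * a) (b * a′)) (cong₂ ℚ._+_ (ι-* b′ a) (ι-* b a′))) ⟨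
      Q ℚ.* ι (b′ * a + b * a′) ∎)
      where
      open ≡-Reasoning
      open +-*-Solver

    ModEq-+ : ∀ w x y z → ModEq p m w x → ModEq p m y z → ModEq p m (w ℚ.+ y) (x ℚ.+ z)
    ModEq-+ w x y z w≡x y≡z = ModEq-lin w x y z (w ℚ.+ y) (x ℚ.+ z) w≡x y≡z
      (solve 4 (λ w x y z → w :+ y :- (x :+ z) := (w :- x) :+ (y :- z)) refl w x y z)
      where open +-*-Solver

    ModEq-trans : ∀ x y z → ModEq p m x y → ModEq p m y z → ModEq p m x z
    ModEq-trans x y z x≡y y≡z = ModEq-lin x y y z x z x≡y y≡z
      (solve 3 (λ x y z → x :- z := (x :- y) :+ (y :- z)) refl x y z)
      where open +-*-Solver

    ModEq-ι* : ∀ c x y → ModEq p m x y → ModEq p m (ι c ℚ.* x) (ι c ℚ.* y)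
    ModEq-ι* c x y (a , b , p∤b , eq) = c * a , b , p∤b , (begin
      ι b ℚ.* (ι c ℚ.* x ℚ.- ι c ℚ.* y)
        ≡⟨ solve 4 (λ b c x y → b :* (c :* x :- c :* y) := c :* (b :* (x :- y))) refl (ι b) (ι c) x y ⟩
      ι c ℚ.* (ι b ℚ.* (x ℚ.- y))
        ≡⟨ cong (ι c ℚ.*_) eq ⟩
      ι c ℚ.* (Q ℚ.* ι a)
        ≡⟨ solve 3 (λ c q a → c :* (q :* a) := q :* (c :* a)) refl (ι c) Q (ι a) ⟩
      Q ℚ.* (ι c ℚ.* ι a)
        ≡⟨ cong (Q ℚ.*_) (ι-* c a) ⟨
      Q ℚ.* ι (c * a) ∎)
      where
      open ≡-Reasoning
      open +-*-Solver

    ModEq-sym : ∀ x y → ModEq p m x y → ModEq p m y x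
    ModEq-sym x y (a , b , p∤b , eq) = - a , b , p∤b , (begin
      ι b ℚ.* (y ℚ.- x)           ≡⟨ solve 3 (λ b x y → b :* (y :- x) := :- (b :* (x :- y))) refl (ι b) x y ⟩
      ℚ.- (ι b ℚ.* (x ℚ.- y))     ≡⟨ cong ℚ.-_ eq ⟩
      ℚ.- (Q ℚ.* ι a)             ≡⟨ ℚ.neg-distribʳ-* Q (ι a) ⟩
      Q ℚ.* (ℚ.- ι a)             ≡⟨ cong (Q ℚ.*_) (ι-neg a) ⟨
      Q ℚ.* ι (- a)               ∎)
      where
      open ≡-Reasoning
      open +-*-Solver

    -- The denominator k itself is the witness: k (1/k - i) = 1 - k i, which the hypothesis makes a
    -- multiple of p^m.
    ModEq-inv : ∀ k i → ¬ p ℕ.∣ k → + (p ℕ.^ m) ∣ + k * i - 1ℤ → ModEq p m (inv k) (ι i)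
    ModEq-inv zero i p∤k _ = contradiction (p ℕ.∣0) p∤k
    ModEq-inv (suc k) i p∤k (divides q eq) = - q , + suc k , p∤k , (begin
      ι (+ suc k) ℚ.* (inv (suc k) ℚ.- ι i)
        ≡⟨ solve 3 (λ k v i → k :* (v :- i) := k :* v :- k :* i) refl (ι (+ suc k)) (inv (suc k)) (ι i) ⟩
      ι (+ suc k) ℚ.* inv (suc k) ℚ.- ι (+ suc k) ℚ.* ι i
        ≡⟨ cong₂ ℚ._-_ (ι-*-inv k) (sym (ι-* (+ suc k) i)) ⟩
      ι 1ℤ ℚ.- ι (+ suc k * i)
        ≡⟨ cong (ι 1ℤ ℚ.+_) (ι-neg (+ suc k * i)) ⟨
      ι 1ℤ ℚ.+ ι (- (+ suc k * i))
        ≡⟨ ι-+ 1ℤ (- (+ suc k * i)) ⟨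
      ι (1ℤ - + suc k * i)
        ≡⟨ cong ι (trans (flip (+ suc k * i)) (trans (cong -_ eq) (commute q (+ (p ℕ.^ m))))) ⟩
      ι (+ (p ℕ.^ m) * - q)
        ≡⟨ ι-* (+ (p ℕ.^ m)) (- q) ⟩
      Q ℚ.* ι (- q) ∎)
      where
      open ≡-Reasoning
      open +-*-Solver
      flip : ∀ x → 1ℤ - x ≡ - (x - 1ℤ)
      flip = solve-∀
      commute : ∀ q x → - (q * x) ≡ x * - q
      commute = solve-∀

    -- The enumeration `k` is arbitrary because `applyUpTo` composes it with `suc` at every step of
    -- the induction.
    ModEq-sumℚ : ∀ n (k : ℕ → ℕ) (F : ℕ → List ℚ) (G : Seq) → (∀ i → ModEq p m (sumℚ (F (k i))) (ι (G i))) →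
      ModEq p m (sumℚ (concatMap F (applyUpTo k n))) (ι (∑ n G))
    ModEq-sumℚ zero    k F G F≡G = ModEq-refl 0ℚ
    ModEq-sumℚ (suc n) k F G F≡G = subst₂ (ModEq p m)
      (sym (sumℚ-++ (F (k 0)) (concatMap F (applyUpTo (k ∘ suc) n)))) (sym (ι-+ (G 0) (∑ n (G ∘ suc))))
      (ModEq-+ (sumℚ (F (k 0))) (ι (G 0)) (sumℚ (concatMap F (applyUpTo (k ∘ suc) n))) (ι (∑ n (G ∘ suc)))
        (F≡G 0) (ModEq-sumℚ n (k ∘ suc) F (G ∘ suc) (F≡G ∘ suc)))
      where
      sumℚ-++ : ∀ xs ys → sumℚ (xs ++ ys) ≡ sumℚ xs ℚ.+ sumℚ ys
      sumℚ-++ []       ys = sym (ℚ.+-identityˡ (sumℚ ys))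
      sumℚ-++ (x ∷ xs) ys = trans (cong (x ℚ.+_) (sumℚ-++ xs ys)) (sym (ℚ.+-assoc x (sumℚ xs) (sumℚ ys)))

  -- From the rational sums to integer convolutions

  ∤-^ : ∀ {p} → Prime p → ∀ {k} → ¬ p ℕ.∣ k → ∀ s → ¬ p ℕ.∣ k ℕ.^ s
  ∤-^ p-prime p∤k zero    = p∤1 p-prime
  ∤-^ p-prime p∤k (suc s) = ∤-* p-prime p∤k (∤-^ p-prime p∤k s)

  ∣-*-1 : ∀ {d} x y → d ∣ x - 1ℤ → d ∣ y - 1ℤ → d ∣ x * y - 1ℤ
  ∣-*-1 {d} x y d∣x d∣y = subst (d ∣_) (telescope x y) (∣m∣n⇒∣m+n (∣m⇒∣m*n y d∣x) d∣y)
    where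
    telescope : ∀ x y → (x - 1ℤ) * y + (y - 1ℤ) ≡ x * y - 1ℤ
    telescope = solve-∀

  x*[y*0]≡0 : ∀ x y → x * (y * 0ℤ) ≡ 0ℤ
  x*[y*0]≡0 = solve-∀

  ∑-truncate : ∀ {m n} {f : Seq} → m ℕ.≤ n → (∀ i → f (m ℕ.+ i) ≡ 0ℤ) → ∑ n f ≡ ∑ m f
  ∑-truncate {m} {n} {f} m≤n f≡0 = begin
    ∑ n f                                             ≡⟨ cong (λ k → ∑ k f) (ℕ.m+[n∸m]≡n m≤n) ⟨
    ∑ (m ℕ.+ (n ∸ m)) f                               ≡⟨ ∑-++ m (n ∸ m) f ⟩
    ∑ m f + ∑ (n ∸ m) (λ i → f (m ℕ.+ i))             ≡⟨ cong (λ s → ∑ m f + s) (∑-zero (n ∸ m) (λ i _ → f≡0 i)) ⟩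
    ∑ m f + 0ℤ                                        ≡⟨ ℤ.+-identityʳ (∑ m f) ⟩
    ∑ m f                                             ∎
    where open ≡-Reasoning

  -- Brings the convolution to the square range of `Z3`: index 0 contributes nothing, and pairs
  -- beyond the triangle have truncated third index 0, where h vanishes.
  ⋆⋆-positive : ∀ (f g h : Seq) → f 0 ≡ 0ℤ → g 0 ≡ 0ℤ → h 0 ≡ 0ℤ → ∀ n →
    (f ⋆ (g ⋆ h)) n ≡ ∑ n (λ i → ∑ n (λ j → f (suc i) * (g (suc j) * h (n ∸ suc i ∸ suc j))))
  ⋆⋆-positive f g h f0 g0 h0 n = trans (drop-0 f (g ⋆ h) f0 n) (∑-cong n (λ i i<n → begin
    f (suc i) * (g ⋆ h) (n ∸ suc i)
      ≡⟨ cong (f (suc i) *_) (trans (drop-0 g h g0 (n ∸ suc i)) (sym (∑-truncate (ℕ.m∸n≤m n (suc i)) (λ j → beyond (n ∸ suc i) j)))) ⟩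
    f (suc i) * ∑ n (λ j → g (suc j) * h (n ∸ suc i ∸ suc j))
      ≡⟨ ∑-*ˡ n (f (suc i)) (λ j → g (suc j) * h (n ∸ suc i ∸ suc j)) ⟨
    ∑ n (λ j → f (suc i) * (g (suc j) * h (n ∸ suc i ∸ suc j))) ∎))
    where
    open ≡-Reasoning
    drop-0 : ∀ (f g : Seq) → f 0 ≡ 0ℤ → ∀ n → (f ⋆ g) n ≡ ∑ n (λ i → f (suc i) * g (n ∸ suc i))
    drop-0 f g f0 n = trans (⋆-def f g n) (trans (cong (λ x → x * g n + ∑ n (λ i → f (suc i) * g (n ∸ suc i))) f0)
      (ℤ.+-identityˡ _))
    beyond : ∀ m j → g (suc (m ℕ.+ j)) * h (m ∸ suc (m ℕ.+ j)) ≡ 0ℤ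
    beyond m j = trans (cong (λ k → g (suc (m ℕ.+ j)) * h k) (ℕ.m≤n⇒m∸n≡0 (ℕ.m≤n⇒m≤1+n (ℕ.m≤m+n m j))))
      (trans (cong (g (suc (m ℕ.+ j)) *_) h0) (ℤ.*-zeroʳ (g (suc (m ℕ.+ j)))))

  module _ {p : ℕ} (p-prime : Prime p) (m t : ℕ)
    (inverse : ∀ {a} → ¬ p ℕ.∣ a → ∀ s → (+ p) ^ m ∣ (+ a) ^ s * (+ a) ^ (s ℕ.* suc (2 ℕ.* t)) - 1ℤ) where

    private
      s* : ℕ → ℕ
      s* s = s ℕ.* suc (2 ℕ.* t)
      U : ℕ → Seq
      U s = unitPower p (s* s)

    -- The decisions are variables, so that the nested conditionals on both sides reduce by matching
    -- on them.
    Z3-term : ∀ a b c N k₁ k₂ → let k₃ = N ∸ k₁ ∸ k₂ in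
      (d : Dec (k₁ ℕ.+ k₂ ℕ.< N)) (d₁ : Dec (p ℕ.∣ k₁)) (d₂ : Dec (p ℕ.∣ k₂)) (d₃ : Dec (p ℕ.∣ k₃)) →
      ModEq p m
        (sumℚ (if does d ∧ not (does d₁) ∧ not (does d₂) ∧ not (does d₃)
          then inv (k₁ ℕ.^ a ℕ.* k₂ ℕ.^ b ℕ.* k₃ ℕ.^ c) ∷ [] else []))
        (ι ((if does d₁ then 0ℤ else (+ k₁) ^ s* a)
          * ((if does d₂ then 0ℤ else (+ k₂) ^ s* b) * (if does d₃ then 0ℤ else (+ k₃) ^ s* c))))
    -- For k₁ + k₂ ≥ N the truncated k₃ is 0, a multiple of p.
    Z3-term a b c N k₁ k₂ (no k₁+k₂≮N) d₁ d₂ (no p∤k₃) = contradiction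
      (subst (p ℕ.∣_) (sym (trans (ℕ.∸-+-assoc N k₁ k₂) (ℕ.m≤n⇒m∸n≡0 (ℕ.≮⇒≥ k₁+k₂≮N)))) (p ℕ.∣0)) p∤k₃
    Z3-term a b c N k₁ k₂ (no _) d₁ d₂ (yes _) = subst (ModEq p m 0ℚ ∘ ι)
      (sym (x*[y*0]≡0 (if does d₁ then 0ℤ else (+ k₁) ^ s* a) (if does d₂ then 0ℤ else (+ k₂) ^ s* b))) (ModEq-refl p-prime m 0ℚ)
    Z3-term a b c N k₁ k₂ (yes _) (yes _) d₂ d₃ = ModEq-refl p-prime m 0ℚ
    Z3-term a b c N k₁ k₂ (yes _) (no _) (yes _) d₃ = subst (ModEq p m 0ℚ ∘ ι) (sym (ℤ.*-zeroʳ ((+ k₁) ^ s* a))) (ModEq-refl p-prime m 0ℚ)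
    Z3-term a b c N k₁ k₂ (yes _) (no _) (no _) (yes _) = subst (ModEq p m 0ℚ ∘ ι)
      (sym (x*[y*0]≡0 ((+ k₁) ^ s* a) ((+ k₂) ^ s* b))) (ModEq-refl p-prime m 0ℚ)
    Z3-term a b c N k₁ k₂ (yes _) (no p∤k₁) (no p∤k₂) (no p∤k₃) = subst (λ x → ModEq p m x (ι product)) (sym (ℚ.+-identityʳ (inv k)))
      (ModEq-inv p-prime m k product
        (∤-* p-prime (∤-* p-prime (∤-^ p-prime p∤k₁ a) (∤-^ p-prime p∤k₂ b)) (∤-^ p-prime p∤k₃ c))
        (subst₂ _∣_ (sym (pos-^ p m)) (cong (_- 1ℤ) regroup)
          (∣-*-1 y₁ (y₂ * y₃) (inverse p∤k₁ a) (∣-*-1 y₂ y₃ (inverse p∤k₂ b) (inverse p∤k₃ c)))))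
      where
      k₃ = N ∸ k₁ ∸ k₂
      k = k₁ ℕ.^ a ℕ.* k₂ ℕ.^ b ℕ.* k₃ ℕ.^ c
      x₁ = (+ k₁) ^ s* a
      x₂ = (+ k₂) ^ s* b
      x₃ = (+ k₃) ^ s* c
      y₁ = (+ k₁) ^ a * x₁
      y₂ = (+ k₂) ^ b * x₂
      y₃ = (+ k₃) ^ c * x₃
      product = x₁ * (x₂ * x₃)
      pos-k : + k ≡ (+ k₁) ^ a * (+ k₂) ^ b * (+ k₃) ^ c
      pos-k = trans (ℤ.pos-* (k₁ ℕ.^ a ℕ.* k₂ ℕ.^ b) (k₃ ℕ.^ c)) (cong₂ _*_
        (trans (ℤ.pos-* (k₁ ℕ.^ a) (k₂ ℕ.^ b)) (cong₂ _*_ (pos-^ k₁ a) (pos-^ k₂ b))) (pos-^ k₃ c))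
      interleave : ∀ y₁ y₂ y₃ x₁ x₂ x₃ → y₁ * x₁ * (y₂ * x₂ * (y₃ * x₃)) ≡ y₁ * y₂ * y₃ * (x₁ * (x₂ * x₃))
      interleave = solve-∀
      regroup : y₁ * (y₂ * y₃) ≡ + k * product
      regroup = trans (interleave ((+ k₁) ^ a) ((+ k₂) ^ b) ((+ k₃) ^ c) x₁ x₂ x₃) (cong (_* product) (sym pos-k))

    Z3-ModEq : ∀ a b c N → ModEq p m (Z3 p N a b c) (ι ((U a ⋆ (U b ⋆ U c)) N))
    Z3-ModEq a b c N = subst (λ i → ModEq p m (Z3 p N a b c) (ι i))
      (sym (⋆⋆-positive (U a) (U b) (U c) (U0 a) (U0 b) (U0 c) N))
      (ModEq-sumℚ p-prime m N suc _ (λ i → ∑ N (term i)) (λ i → ModEq-sumℚ p-prime m N suc _ (term i) (λ j →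
        Z3-term a b c N (suc i) (suc j) (suc i ℕ.+ suc j ℕ.<? N) (p ℕ.∣? suc i) (p ℕ.∣? suc j) (p ℕ.∣? (N ∸ suc i ∸ suc j)))))
      where
      term : ℕ → ℕ → ℤ
      term i j = U a (suc i) * (U b (suc j) * U c (N ∸ suc i ∸ suc j))
      U0 : ∀ s → U s 0 ≡ 0ℤ
      U0 s = unitPower-∣ (s* s) (p ℕ.∣0)

  -- Signs, the bound p ≥ 5 and the congruence for both parities

  -1^-odd-multiple : ∀ s t → -1ℤ ^ (s ℕ.* suc (2 ℕ.* t)) ≡ -1ℤ ^ s
  -1^-odd-multiple s t = begin
    -1ℤ ^ (s ℕ.* suc (2 ℕ.* t))     ≡⟨ cong (-1ℤ ^_) (ℕ.*-comm s (suc (2 ℕ.* t))) ⟩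
    -1ℤ ^ (suc (2 ℕ.* t) ℕ.* s)     ≡⟨ ℤ.^-*-assoc -1ℤ (suc (2 ℕ.* t)) s ⟨
    (-1ℤ * -1ℤ ^ (2 ℕ.* t)) ^ s     ≡⟨ cong (λ x → (-1ℤ * x) ^ s) (trans (sym (ℤ.^-*-assoc -1ℤ 2 t)) (ℤ.^-zeroˡ t)) ⟩
    -1ℤ ^ s                         ∎
    where open ≡-Reasoning

  -1^[2+n] : ∀ n → -1ℤ ^ (2 ℕ.+ n) ≡ -1ℤ ^ n
  -1^[2+n] n = cancel (-1ℤ ^ n)
    where
    cancel : ∀ x → -1ℤ * (-1ℤ * x) ≡ x
    cancel = solve-∀

  -1^even : ∀ {n} → 2 ℕ.∣ n → -1ℤ ^ n ≡ -1ℤ ^ 2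
  -1^even (ℕ.divides q refl) = trans (cong (-1ℤ ^_) (ℕ.*-comm q 2)) (trans (sym (ℤ.^-*-assoc -1ℤ 2 q)) (ℤ.^-zeroˡ q))

  -1^odd : ∀ n → ¬ 2 ℕ.∣ n → -1ℤ ^ n ≡ -1ℤ ^ 1
  -1^odd zero          2∤n = contradiction (2 ℕ.∣0) 2∤n
  -1^odd (suc zero)    2∤n = refl
  -1^odd (suc (suc n)) 2∤n = trans (-1^[2+n] n) (-1^odd n (λ 2∣n → 2∤n (ℕ.∣m∣n⇒∣m+n ℕ.∣-refl 2∣n)))

  ¬prime[4] : ¬ Prime 4
  ¬prime[4] 4-prime = [ 4∤2 , 4∤2 ]′ (euclidsLemma 2 2 4-prime ℕ.∣-refl)
    where
    4∤2 : ¬ 4 ℕ.∣ 2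
    4∤2 = ℕ.>⇒∤ (s≤s (s≤s (s≤s z≤n)))

  -- Three positive exponents have sum at least 3, so p > 3, and 4 is not prime. This is the origin
  -- of the bound 5 on p.
  3<prime⇒5≤ : ∀ {p} → Prime p → 3 ℕ.< p → 5 ℕ.≤ p
  3<prime⇒5≤ p-prime 3<p = ℕ.≤∧≢⇒< 3<p (λ { refl → ¬prime[4] p-prime })

  -- Both parities at once, with r lowered by one. Each rational sum is congruent to its integer
  -- convolution, and the convolutions are compared by `unitPower-⋆-⋆-congruence`. For r = 0 the two
  -- sides coincide.
  Z3-congruence : ∀ {p} → Prime p → 5 ℕ.≤ p → ∀ {e} → e ≡ 1 ⊎ e ≡ 2 → ∀ r α β γ → -1ℤ ^ (α ℕ.+ β ℕ.+ γ) ≡ -1ℤ ^ e →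
    ModEq p (suc r ℕ.* e) (Z3 p (p ℕ.^ suc r) α β γ) (((+ (p ℕ.^ (r ℕ.* e))) / 1) ℚ.* Z3 p p α β γ)
  Z3-congruence {p} p-prime 5≤p {e} e≡1⊎2 zero α β γ sign = subst₂ (ModEq p (1 ℕ.* e))
    (cong (λ n → Z3 p n α β γ) (sym (ℕ.*-identityʳ p))) (sym (ℚ.*-identityˡ (Z3 p p α β γ))) (ModEq-refl p-prime (1 ℕ.* e) (Z3 p p α β γ))
  Z3-congruence {p@(suc p-1)} p-prime 5≤p {e@(suc _)} e≡1⊎2 r@(suc r-1) α β γ sign
    -- `inverse-power` works modulo p^(k+1), hence the predecessor of m, which is positive as e ≥ 1.
    -- The same u serves both sums, so that they become values of one convolution.
    with u , inverse ← inverse-power p-prime (ℕ.pred (suc r ℕ.* e))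
    = ModEq-trans p-prime m X (ι (I (p ℕ.^ suc r))) (ι c ℚ.* Y) (Z3-ModEq p-prime m u inverse α β γ (p ℕ.^ suc r))
        (ModEq-trans p-prime m (ι (I (p ℕ.^ suc r))) (ι (c * I p)) (ι c ℚ.* Y) (ModEq-ι p-prime m (I (p ℕ.^ suc r)) (c * I p) I-congruence)
          (subst (λ y → ModEq p m y (ι c ℚ.* Y)) (sym (ι-* c (I p)))
            (ModEq-ι* p-prime m c (ι (I p)) Y (ModEq-sym p-prime m Y (ι (I p)) (Z3-ModEq p-prime m u inverse α β γ p)))))
    where
    open ≡-Reasoning
    m = suc r ℕ.* e
    X = Z3 p (p ℕ.^ suc r) α β γ
    Y = Z3 p p α β γ
    c = + (p ℕ.^ (r ℕ.* e))
    s* : ℕ → ℕ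
    s* s = s ℕ.* suc (2 ℕ.* u)
    I : Seq
    I = unitPower p (s* α) ⋆ (unitPower p (s* β) ⋆ unitPower p (s* γ))
    n = p ℕ.^ r
    instance _ = ℕ.m^n≢0 p r-1
    t = n ∸ 2
    2+t≡n : 2 ℕ.+ t ≡ n
    2+t≡n = ℕ.m+[n∸m]≡n (ℕ.≤-trans (ℕ.≤-trans (s≤s (s≤s z≤n)) 5≤p) (ℕ.m≤m*n p (p ℕ.^ r-1)))
    N≡pʳ : + 2 + + t ≡ (+ p) ^ r
    N≡pʳ = trans (cong +_ 2+t≡n) (pos-^ p r)
    signs : -1ℤ ^ s* α * (-1ℤ ^ s* β * -1ℤ ^ s* γ) ≡ -1ℤ ^ e
    signs = begin
      -1ℤ ^ s* α * (-1ℤ ^ s* β * -1ℤ ^ s* γ)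
        ≡⟨ cong₂ _*_ (-1^-odd-multiple α u) (cong₂ _*_ (-1^-odd-multiple β u) (-1^-odd-multiple γ u)) ⟩
      -1ℤ ^ α * (-1ℤ ^ β * -1ℤ ^ γ)
        ≡⟨ ℤ.*-assoc (-1ℤ ^ α) (-1ℤ ^ β) (-1ℤ ^ γ) ⟨
      -1ℤ ^ α * -1ℤ ^ β * -1ℤ ^ γ
        ≡⟨ cong (_* -1ℤ ^ γ) (ℤ.^-distribˡ-+-* -1ℤ α β) ⟨
      -1ℤ ^ (α ℕ.+ β) * -1ℤ ^ γ
        ≡⟨ ℤ.^-distribˡ-+-* -1ℤ (α ℕ.+ β) γ ⟨
      -1ℤ ^ (α ℕ.+ β ℕ.+ γ)
        ≡⟨ sign ⟩
      -1ℤ ^ e ∎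
    modulus : (+ p * (+ 2 + + t)) ^ e ≡ + (p ℕ.^ m)
    modulus = begin
      (+ p * (+ 2 + + t)) ^ e   ≡⟨ cong (λ x → (+ p * x) ^ e) N≡pʳ ⟩
      ((+ p) ^ suc r) ^ e       ≡⟨ ℤ.^-*-assoc (+ p) (suc r) e ⟩
      (+ p) ^ m                 ≡⟨ pos-^ p m ⟨
      + (p ℕ.^ m)               ∎
    factor : (+ 2 + + t) ^ e ≡ c
    factor = begin
      (+ 2 + + t) ^ e           ≡⟨ cong (_^ e) N≡pʳ ⟩
      ((+ p) ^ r) ^ e           ≡⟨ ℤ.^-*-assoc (+ p) r e ⟩
      (+ p) ^ (r ℕ.* e)         ≡⟨ pos-^ p (r ℕ.* e) ⟨
      c                         ∎
    I-congruence : + (p ℕ.^ m) ∣ I (p ℕ.^ suc r) - c * I p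
    I-congruence = subst₂ _∣_ modulus
      (cong₂ _-_ (cong (λ k → I (p ℕ.* k)) 2+t≡n) (cong₂ (λ x k → x * I k) factor (ℕ.*-identityʳ p)))
      (unitPower-⋆-⋆-congruence p-prime 5≤p e≡1⊎2 (s* α) (s* β) (s* γ) signs r t N≡pʳ)
  Z3-congruence _ _ {zero} (inj₁ ()) (suc _)
  Z3-congruence _ _ {zero} (inj₂ ()) (suc _)

open import Data.Nat using (ℕ; _+_; _*_; _∸_; _^_; _<_)
open import Data.Nat.Primality using (Prime)
open import Data.Rational using (_/_) renaming (_*_ to _*ℚ_)
open import Data.Integer using (+_)
open import Data.Nat.Divisibility using (_∣_)
open import Relation.Nullary using (¬_)
open import Data.Product using (_×_)
open import Data.Nat using (suc; _≤_)
open import Data.Nat.Properties using (*-identityʳ; *-comm; +-mono-≤; ≤-<-trans)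
open import Data.Product using (_,_)
open import Data.Sum using (inj₁; inj₂)
open import Relation.Binary.PropositionalEquality using (refl; cong; subst₂)
open ThreefoldSums using (Z3-congruence; -1^odd; -1^even; 3<prime⇒5≤)

theorem3p2 : (r α β γ p : ℕ) → 0 < r → 0 < α → 0 < β → 0 < γ → Prime p → α + β + γ < p →
    (¬ (2 ∣ α + β + γ) → ModEq p r (Z3 p (p ^ r) α β γ) (((+ (p ^ (r ∸ 1))) / 1) *ℚ Z3 p p α β γ))
    × (2 ∣ α + β + γ → ModEq p (2 * r) (Z3 p (p ^ r) α β γ) (((+ (p ^ (2 * r ∸ 2))) / 1) *ℚ Z3 p p α β γ))
theorem3p2 (suc r) α β γ p _ 0<α 0<β 0<γ p-prime w<p =
  (λ 2∤w → subst₂ (λ m k → ModEq p m X (((+ (p ^ k)) / 1) *ℚ Y))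
    (*-identityʳ (suc r)) (*-identityʳ r) (Z3-congruence p-prime 5≤p (inj₁ refl) r α β γ (-1^odd _ 2∤w))) ,
  (λ 2∣w → subst₂ (λ m k → ModEq p m X (((+ (p ^ k)) / 1) *ℚ Y))
    (*-comm (suc r) 2) (cong (_∸ 2) (*-comm (suc r) 2))
    (Z3-congruence p-prime 5≤p (inj₂ refl) r α β γ (-1^even 2∣w)))
  where
  X = Z3 p (p ^ suc r) α β γ
  Y = Z3 p p α β γ
  5≤p : 5 ≤ p
  5≤p = 3<prime⇒5≤ p-prime (≤-<-trans (+-mono-≤ (+-mono-≤ 0<α 0<β) 0<γ) w<p)
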